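{- Let $F$ be a field of characteristic $p>0$, let $G$ be a locally pro-$p$ group, and let $C$ be a closed subgroup of the center of $G$. Suppose $(G,K)$ is $C$-fair for some open subgroup $K\subset G$ which is pro-$p$ in the induced topology. Then for every continuous character $\chi:C\to F^\times$ there are no nonzero projective objects in the category $\mathrm{Mod}_F^\chi(G)$.
   Context: A topological group is locally pro-$p$ if it has an open subgroup which is pro-$p$ in the induced topology. $F^\times$ carries the discrete topology. A representation of $G$ on an $F$-vector space is smooth if every vector has open stabilizer. $\mathrm{Mod}_F^\chi(G)$ is the abelian category of smooth $G$-representations on $F$-vector spaces on which $C$ acts via the character $\chi$ (morphisms are $G$-equivariant $F$-linear maps); projective means projective in this category. Definition ($C$-fair): for an open pro-$p$ subgroup $K\subset G$ and a closed central subgroup $C\subset G$, the pair $(G,K)$ is $C$-fair if for every open subgroup $H\subset K$ there is an open subgroup $H'\subset K$ such that for all $g\in G$ one has a strict inclusion $K\cap gH'Cg^{ -1}\subsetneq K\cap gHCg^{ -1}$. -}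

module Defs where

open import Algebra.Bundles using (Group; CommutativeRing)
open import Algebra.Definitions using (Invertible)
import Algebra.Definitions.RawMonoid as RawMonoidDefs
open import Algebra.Module.Bundles using (LeftModule)
import Algebra.Module.Morphism.Construct.Composition as ModComp
open import Algebra.Module.Morphism.Structures using (module LeftModuleMorphisms)
open import Algebra.Morphism.Structures using (module GroupMorphisms)
import Algebra.Properties.Group as GroupProps
open import Data.Fin.Base using (Fin)
open import Data.List.Base using (List)
open import Data.List.Relation.Unary.Any using (Any)
open import Data.Nat.Base using (ℕ; _^_)
open import Data.Nat.Divisibility using (_∣_)
open import Data.Product.Base using (Σ; Σ-syntax; ∃-syntax; _×_; _,_; proj₁; proj₂; uncurry; map)
open import Data.Product.Relation.Binary.Pointwise.NonDependent using (×-setoid)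
open import Data.Unit.Polymorphic.Base using (⊤; tt)
open import Function.Base using (_∘_; _∘′_)
open import Function.Bundles using (Inverse; _⇔_)
open import Level using (Level; suc; Lift; lift; lower)
open import Relation.Binary.Bundles using (Setoid)
import Relation.Binary.Construct.On as On
open import Relation.Binary.Definitions using (_Respects_)
open import Relation.Binary.PropositionalEquality using () renaming (setoid to ≡-setoid)
import Relation.Binary.Reasoning.Setoid as SetoidReasoning
open import Relation.Nullary.Negation using (¬_)
open import Relation.Unary using (Pred; _⊆_; _⊂_; _≐_; _∩_; _∪_; _≬_; ∁; ⋃)

-- A subset of a setoid is a predicate respecting _≈_, so open
-- sets are required to respect it.  The empty set is the union of the
-- empty family.  IsOpen lands in Set (suc ℓ) so that the induced topology
-- is again a Topology.

record Topology {ℓ : Level} (S : Setoid ℓ ℓ) : Set (suc (suc ℓ)) where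
  open Setoid S
  field
    IsOpen      : Pred Carrier ℓ → Set (suc ℓ)
    open-resp-≈ : ∀ {U} → IsOpen U → U Respects _≈_
    open-resp-≐ : ∀ {U V} → U ≐ V → IsOpen U → IsOpen V
    open-⊤      : IsOpen (λ _ → ⊤)
    open-∩      : ∀ {U V} → IsOpen U → IsOpen V → IsOpen (U ∩ V)
    open-⋃      : ∀ {I : Set ℓ} {U : I → Pred Carrier ℓ} →
                  (∀ i → IsOpen (U i)) → IsOpen (⋃ I U)

  IsClosed : Pred Carrier ℓ → Set (suc ℓ)
  IsClosed A = IsOpen (∁ A)

  IsCompact : Set (suc ℓ)
  IsCompact = ∀ {I : Set ℓ} (U : I → Pred Carrier ℓ) → (∀ i → IsOpen (U i)) →
              (∀ x → ∃[ i ] U i x) → Σ[ is ∈ List I ] (∀ x → Any (λ i → U i x) is)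

  IsHausdorff : Set (suc ℓ)
  IsHausdorff = ∀ {x y} → ¬ (x ≈ y) →
    Σ[ U ∈ Pred Carrier ℓ ] Σ[ V ∈ Pred Carrier ℓ ]
      (IsOpen U × IsOpen V × U x × V y × ¬ (U ≬ V))

  -- Connectedness of A in its subspace topology, phrased with open sets of S.
  IsConnected : Pred Carrier ℓ → Set (suc ℓ)
  IsConnected A = ∀ {U V} → IsOpen U → IsOpen V → A ⊆ (U ∪ V) →
                  A ≬ U → A ≬ V → A ≬ (U ∩ V)

  IsTotallyDisconnected : Set (suc ℓ)
  IsTotallyDisconnected = ∀ A → IsConnected A → ∀ {x y} → A x → A y → x ≈ y

Continuous : ∀ {ℓ} {S S′ : Setoid ℓ ℓ} → Topology S → Topology S′ →
             (Setoid.Carrier S → Setoid.Carrier S′) → Set (suc ℓ)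
Continuous T T′ f = ∀ {U} → Topology.IsOpen T′ U → Topology.IsOpen T (U ∘ f)

discrete : ∀ {ℓ} (S : Setoid ℓ ℓ) → Topology S
discrete {ℓ} S = record
  { IsOpen      = λ U → Lift (suc ℓ) (U Respects _≈_)
  ; open-resp-≈ = lower
  ; open-resp-≐ = λ { (U⊆V , V⊆U) (lift r) → lift (λ x≈y → U⊆V ∘ r x≈y ∘ V⊆U) }
  ; open-⊤      = lift (λ _ _ → tt)
  ; open-∩      = λ { (lift r) (lift s) → lift (λ x≈y → map (r x≈y) (s x≈y)) }
  ; open-⋃      = λ r → lift (λ { x≈y (i , u) → i , lower (r i) x≈y u })
  }
  where open Setoid S

induced : ∀ {ℓ} {S : Setoid ℓ ℓ} {B : Set ℓ} (f : B → Setoid.Carrier S) →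
          Topology S → Topology (On.setoid S f)
induced {ℓ} {S} f T = record
  { IsOpen      = λ U → Σ[ V ∈ Pred (Setoid.Carrier S) ℓ ] (T.IsOpen V × U ≐ (V ∘ f))
  ; open-resp-≈ = λ { (V , oV , U⊆V , V⊆U) x≈y → V⊆U ∘ T.open-resp-≈ oV x≈y ∘ U⊆V }
  ; open-resp-≐ = λ { (U⊆U′ , U′⊆U) (V , oV , U⊆V , V⊆U) →
                      V , oV , (λ u → U⊆V (U′⊆U u)) , (λ v → U⊆U′ (V⊆U v)) }
  ; open-⊤      = (λ _ → ⊤) , T.open-⊤ , (λ _ → tt) , (λ _ → tt)
  ; open-∩      = λ { (V , oV , U⊆V , V⊆U) (V′ , oV′ , U′⊆V′ , V′⊆U′) →
                      V ∩ V′ , T.open-∩ oV oV′ , map U⊆V U′⊆V′ , map V⊆U V′⊆U′ }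
  ; open-⋃      = λ h → ⋃ _ (λ i → proj₁ (h i)) , T.open-⋃ (λ i → proj₁ (proj₂ (h i)))
                      , (λ { (i , u) → i , proj₁ (proj₂ (proj₂ (h i))) u })
                      , (λ { (i , v) → i , proj₂ (proj₂ (proj₂ (h i))) v })
  }
  where module T = Topology T

product : ∀ {ℓ} {S S′ : Setoid ℓ ℓ} → Topology S → Topology S′ → Topology (×-setoid S S′)
product {ℓ} {S} {S′} T T′ = record
  { IsOpen      = IsOpen×
  ; open-resp-≈ = λ { o (x≈x′ , y≈y′) u → let (V , W , oV , oW , v , w , VW⊆U) = o u in
                      VW⊆U (T.open-resp-≈ oV x≈x′ v) (T′.open-resp-≈ oW y≈y′ w) }
  ; open-resp-≐ = λ { (U⊆U′ , U′⊆U) o u → let (V , W , oV , oW , v , w , VW⊆U) = o (U′⊆U u) in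
                      V , W , oV , oW , v , w , (λ v′ w′ → U⊆U′ (VW⊆U v′ w′)) }
  ; open-⊤      = λ _ → (λ _ → ⊤) , (λ _ → ⊤) , T.open-⊤ , T′.open-⊤ , tt , tt , (λ _ _ → tt)
  ; open-∩      = λ { o o′ (u , u′) →
                      let (V  , W  , oV  , oW  , v  , w  , VW⊆U) = o u
                          (V′ , W′ , oV′ , oW′ , v′ , w′ , VW⊆U′) = o′ u′ in
                      V ∩ V′ , W ∩ W′ , T.open-∩ oV oV′ , T′.open-∩ oW oW′ , (v , v′) , (w , w′) ,
                      (λ { (a , a′) (b , b′) → VW⊆U a b , VW⊆U′ a′ b′ }) }
  ; open-⋃      = λ { o (i , u) → let (V , W , oV , oW , v , w , VW⊆U) = o i u in
                      V , W , oV , oW , v , w , (λ a b → i , VW⊆U a b) }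
  }
  where
  module T  = Topology T
  module T′ = Topology T′
  IsOpen× : Pred (Setoid.Carrier S × Setoid.Carrier S′) ℓ → Set (suc ℓ)
  IsOpen× U = ∀ {x y} → U (x , y) →
    Σ[ V ∈ Pred (Setoid.Carrier S) ℓ ] Σ[ W ∈ Pred (Setoid.Carrier S′) ℓ ]
      (T.IsOpen V × T′.IsOpen W × V x × W y × (∀ {a b} → V a → W b → U (a , b)))

record Subgroup {ℓ : Level} (G : Group ℓ ℓ) : Set (suc ℓ) where
  open Group G
  field
    ⌞_⌟       : Pred Carrier ℓ
    resp-≈    : ⌞_⌟ Respects _≈_
    ε-closed  : ⌞_⌟ ε
    ∙-closed  : ∀ {x y} → ⌞_⌟ x → ⌞_⌟ y → ⌞_⌟ (x ∙ y)
    ⁻¹-closed : ∀ {x} → ⌞_⌟ x → ⌞_⌟ (x ⁻¹)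

open Subgroup public using (⌞_⌟)

IsNormal : ∀ {ℓ} {G : Group ℓ ℓ} → Subgroup G → Set ℓ
IsNormal {G = G} N = ∀ g {n} → ⌞ N ⌟ n → ⌞ N ⌟ (g ∙ n ∙ g ⁻¹)
  where open Group G

IsCentral : ∀ {ℓ} {G : Group ℓ ℓ} → Subgroup G → Set ℓ
IsCentral {G = G} C = ∀ {c} → ⌞ C ⌟ c → ∀ g → c ∙ g ≈ g ∙ c
  where open Group G

subgroup : ∀ {ℓ} {G : Group ℓ ℓ} → Subgroup G → Group ℓ ℓ
subgroup {G = G} H = record
  { Carrier = Σ Carrier ⌞ H ⌟
  ; _≈_     = λ x y → proj₁ x ≈ proj₁ y
  ; _∙_     = λ { (x , hx) (y , hy) → x ∙ y , Subgroup.∙-closed H hx hy }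
  ; ε       = ε , Subgroup.ε-closed H
  ; _⁻¹     = λ { (x , hx) → x ⁻¹ , Subgroup.⁻¹-closed H hx }
  ; isGroup = record
    { isMonoid = record
      { isSemigroup = record
        { isMagma = record
          { isEquivalence = On.isEquivalence proj₁ isEquivalence
          ; ∙-cong        = ∙-cong
          }
        ; assoc = λ x y z → assoc (proj₁ x) (proj₁ y) (proj₁ z)
        }
      ; identity = (λ x → identityˡ (proj₁ x)) , (λ x → identityʳ (proj₁ x))
      }
    ; inverse = (λ x → inverseˡ (proj₁ x)) , (λ x → inverseʳ (proj₁ x))
    ; ⁻¹-cong = ⁻¹-cong
    }
  }
  where open Group G

cosets : ∀ {ℓ} (G : Group ℓ ℓ) → Subgroup G → Setoid ℓ ℓ
cosets G H = record
  { Carrier       = Carrier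
  ; _≈_           = λ x y → ⌞ H ⌟ (x ⁻¹ ∙ y)
  ; isEquivalence = record
    { refl  = λ {x} → H.resp-≈ (sym (inverseˡ x)) H.ε-closed
    ; sym   = λ {x} {y} h → H.resp-≈ (flip-eq x y) (H.⁻¹-closed h)
    ; trans = λ {x} {y} {z} h k → H.resp-≈ (cancel x y z) (H.∙-closed h k)
    }
  }
  where
  open Group G
  open GroupProps G using (⁻¹-anti-homo-∙; ⁻¹-involutive)
  open SetoidReasoning setoid
  module H = Subgroup H

  flip-eq : ∀ x y → (x ⁻¹ ∙ y) ⁻¹ ≈ y ⁻¹ ∙ x
  flip-eq x y = trans (⁻¹-anti-homo-∙ (x ⁻¹) y) (∙-congˡ (⁻¹-involutive x))

  cancel : ∀ x y z → (x ⁻¹ ∙ y) ∙ (y ⁻¹ ∙ z) ≈ x ⁻¹ ∙ z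
  cancel x y z = begin
    (x ⁻¹ ∙ y) ∙ (y ⁻¹ ∙ z)  ≈⟨ assoc (x ⁻¹) y (y ⁻¹ ∙ z) ⟩
    x ⁻¹ ∙ (y ∙ (y ⁻¹ ∙ z))  ≈⟨ ∙-congˡ (assoc y (y ⁻¹) z) ⟨
    x ⁻¹ ∙ (y ∙ y ⁻¹ ∙ z)    ≈⟨ ∙-congˡ (∙-congʳ (inverseʳ y)) ⟩
    x ⁻¹ ∙ (ε ∙ z)           ≈⟨ ∙-congˡ (identityˡ z) ⟩
    x ⁻¹ ∙ z                 ∎

module _ {ℓ : Level} (G : Group ℓ ℓ) where
  open Group G

  setProduct : Pred Carrier ℓ → Pred Carrier ℓ → Pred Carrier ℓ
  setProduct A B x = ∃[ a ] ∃[ b ] (A a × B b × x ≈ a ∙ b)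

  conjugate : Carrier → Pred Carrier ℓ → Pred Carrier ℓ
  conjugate g A x = ∃[ a ] (A a × x ≈ g ∙ a ∙ g ⁻¹)

record TopologicalGroup (ℓ : Level) : Set (suc (suc ℓ)) where
  field
    group    : Group ℓ ℓ
    topology : Topology (Group.setoid group)
  open Group group public
  open Topology topology public
  field
    ∙-continuous  : Continuous (product topology topology) topology (uncurry _∙_)
    ⁻¹-continuous : Continuous topology topology _⁻¹

subgroupᵗ : ∀ {ℓ} (G : TopologicalGroup ℓ) → Subgroup (TopologicalGroup.group G) → TopologicalGroup ℓ
subgroupᵗ G H = record
  { group         = subgroup H
  ; topology      = induced proj₁ topology
  ; ∙-continuous  = λ { (V , oV , U⊆V , V⊆U) u →
      let (A , B , oA , oB , a , b , AB⊆V) = ∙-continuous oV (U⊆V u) in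
      A ∘ proj₁ , B ∘ proj₁
      , (A , oA , (λ z → z) , (λ z → z)) , (B , oB , (λ z → z) , (λ z → z))
      , a , b , (λ a′ b′ → V⊆U (AB⊆V a′ b′)) }
  ; ⁻¹-continuous = λ { (V , oV , U⊆V , V⊆U) →
      V ∘ _⁻¹ , ⁻¹-continuous oV , (λ u → U⊆V u) , (λ v → V⊆U v) }
  }
  where open TopologicalGroup G

discreteGroup : ∀ {ℓ} → Group ℓ ℓ → TopologicalGroup ℓ
discreteGroup G = record
  { group         = G
  ; topology      = discrete setoid
  ; ∙-continuous  = λ { (lift r) {x} {y} u →
      (x ≈_) , (y ≈_)
      , lift (λ a≈b x≈a → trans x≈a a≈b) , lift (λ a≈b y≈a → trans y≈a a≈b)
      , refl , refl , (λ x≈a y≈b → r (∙-cong x≈a y≈b) u) }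
  ; ⁻¹-continuous = λ { (lift r) → lift (λ x≈y → r (⁻¹-cong x≈y)) }
  }
  where open Group G

record ContinuousHom {ℓ : Level} (G H : TopologicalGroup ℓ) : Set (suc ℓ) where
  private
    module G = TopologicalGroup G
    module H = TopologicalGroup H
  open GroupMorphisms G.rawGroup H.rawGroup
  field
    ⟦_⟧                 : G.Carrier → H.Carrier
    isGroupHomomorphism : IsGroupHomomorphism ⟦_⟧
    continuous          : Continuous G.topology H.topology ⟦_⟧

-- Pro-p: profinite (compact, Hausdorff, totally disconnected), and the
-- quotient by every open normal subgroup has order a power of p.

record IsProP {ℓ : Level} (p : ℕ) (G : TopologicalGroup ℓ) : Set (suc ℓ) where
  open TopologicalGroup G
  field
    compact             : IsCompact
    hausdorff           : IsHausdorff
    totallyDisconnected : IsTotallyDisconnected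
    quotients           : ∀ (N : Subgroup group) → IsOpen ⌞ N ⌟ → IsNormal N →
                          ∃[ n ] Inverse (≡-setoid (Fin (p ^ n))) (cosets group N)

IsLocallyProP : ∀ {ℓ} → ℕ → TopologicalGroup ℓ → Set (suc ℓ)
IsLocallyProP p G = Σ[ K ∈ Subgroup group ] (IsOpen ⌞ K ⌟ × IsProP p (subgroupᵗ G K))
  where open TopologicalGroup G

-- K is open, so an open subgroup of K is a subgroup of G contained in K and
-- open in G.

IsFair : ∀ {ℓ} (G : TopologicalGroup ℓ) (C K : Subgroup (TopologicalGroup.group G)) → Set (suc ℓ)
IsFair G C K =
  ∀ (H : Subgroup group) → IsOpen ⌞ H ⌟ → ⌞ H ⌟ ⊆ ⌞ K ⌟ →
  Σ[ H′ ∈ Subgroup group ] (IsOpen ⌞ H′ ⌟ × ⌞ H′ ⌟ ⊆ ⌞ K ⌟ ×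
    (∀ g → (⌞ K ⌟ ∩ conjugate group g (setProduct group ⌞ H′ ⌟ ⌞ C ⌟))
         ⊂ (⌞ K ⌟ ∩ conjugate group g (setProduct group ⌞ H ⌟ ⌞ C ⌟))))
  where open TopologicalGroup G

record Field (ℓ : Level) : Set (suc ℓ) where
  field
    commutativeRing : CommutativeRing ℓ ℓ
  open CommutativeRing commutativeRing public
  field
    1≉0        : ¬ (1# ≈ 0#)
    invertible : ∀ {x} → ¬ (x ≈ 0#) → Invertible _≈_ 1# _*_ x

-- p generates the kernel of the canonical map from the integers; n × 1# is
-- the n-fold sum of 1#.

HasCharacteristic : ∀ {ℓ} → Field ℓ → ℕ → Set ℓ
HasCharacteristic F p = ∀ n → (n · 1# ≈ 0#) ⇔ (p ∣ n)
  where
  open Field F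
  open RawMonoidDefs +-rawMonoid using () renaming (_×_ to _·_)

unitGroup : ∀ {ℓ} → Field ℓ → Group ℓ ℓ
unitGroup F = record
  { Carrier = Σ Carrier (Invertible _≈_ 1# _*_)
  ; _≈_     = λ x y → proj₁ x ≈ proj₁ y
  ; _∙_     = λ { (x , x′ , l , r) (y , y′ , l′ , r′) →
                  x * y , x′ * y′ , mul x′ y′ x y l l′ , mul x y x′ y′ r r′ }
  ; ε       = 1# , 1# , *-identityˡ 1# , *-identityˡ 1#
  ; _⁻¹     = λ { (x , x′ , l , r) → x′ , x , r , l }
  ; isGroup = record
    { isMonoid = record
      { isSemigroup = record
        { isMagma = record
          { isEquivalence = On.isEquivalence proj₁ isEquivalence
          ; ∙-cong        = *-cong
          }
        ; assoc = λ x y z → *-assoc (proj₁ x) (proj₁ y) (proj₁ z)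
        }
      ; identity = (λ x → *-identityˡ (proj₁ x)) , (λ x → *-identityʳ (proj₁ x))
      }
    ; inverse = (λ { (_ , _ , l , _) → l }) , (λ { (_ , _ , _ , r) → r })
    ; ⁻¹-cong = λ {x} {y} → inv-cong x y
    }
  }
  where
  open Field F
  open SetoidReasoning setoid

  mul : ∀ a b c d → a * c ≈ 1# → b * d ≈ 1# → (a * b) * (c * d) ≈ 1#
  mul a b c d ac bd = begin
    (a * b) * (c * d)  ≈⟨ *-assoc a b (c * d) ⟩
    a * (b * (c * d))  ≈⟨ *-congˡ (*-congˡ (*-comm c d)) ⟩
    a * (b * (d * c))  ≈⟨ *-congˡ (*-assoc b d c) ⟨
    a * (b * d * c)    ≈⟨ *-congˡ (*-congʳ bd) ⟩
    a * (1# * c)       ≈⟨ *-congˡ (*-identityˡ c) ⟩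
    a * c              ≈⟨ ac ⟩
    1#                 ∎

  inv-cong : ∀ (x y : Σ Carrier (Invertible _≈_ 1# _*_)) → proj₁ x ≈ proj₁ y →
             proj₁ (proj₂ x) ≈ proj₁ (proj₂ y)
  inv-cong (x , x′ , l , r) (y , y′ , l′ , r′) x≈y = begin
    x′             ≈⟨ *-identityʳ x′ ⟨
    x′ * 1#        ≈⟨ *-congˡ r′ ⟨
    x′ * (y * y′)  ≈⟨ *-congˡ (*-congʳ x≈y) ⟨
    x′ * (x * y′)  ≈⟨ *-assoc x′ x y′ ⟨
    x′ * x * y′    ≈⟨ *-congʳ l ⟩
    1# * y′        ≈⟨ *-identityˡ y′ ⟩
    y′             ∎

-- The category Mod_F^χ(G).  F, G and all representations live in one universe
-- ℓ; epimorphisms and projectives are tested against every object there.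

ContinuousCharacter : ∀ {ℓ} → Field ℓ → TopologicalGroup ℓ → Set (suc ℓ)
ContinuousCharacter F C = ContinuousHom C (discreteGroup (unitGroup F))

module Mod {ℓ : Level} (F : Field ℓ) (G : TopologicalGroup ℓ)
           (C : Subgroup (TopologicalGroup.group G))
           (χ : ContinuousCharacter F (subgroupᵗ G C)) where

  private
    module F = Field F
    module G = TopologicalGroup G
    module χ = ContinuousHom χ

  record SmoothRep : Set (suc ℓ) where
    field
      vectorSpace : LeftModule F.ring ℓ ℓ
    open LeftModule vectorSpace public
    infixr 8 _▷_
    field
      _▷_        : G.Carrier → Carrierᴹ → Carrierᴹ
      ▷-cong     : ∀ {g h v w} → g G.≈ h → v ≈ᴹ w → g ▷ v ≈ᴹ h ▷ w
      ▷-identity : ∀ v → G.ε ▷ v ≈ᴹ v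
      ▷-assoc    : ∀ g h v → (g G.∙ h) ▷ v ≈ᴹ g ▷ h ▷ v
      ▷-+ᴹ       : ∀ g v w → g ▷ (v +ᴹ w) ≈ᴹ g ▷ v +ᴹ g ▷ w
      ▷-*ₗ       : ∀ g a v → g ▷ (a *ₗ v) ≈ᴹ a *ₗ (g ▷ v)
      smooth     : ∀ v → G.IsOpen (λ g → g ▷ v ≈ᴹ v)
      character  : ∀ c v → proj₁ c ▷ v ≈ᴹ proj₁ χ.⟦ c ⟧ *ₗ v

  IsZero : SmoothRep → Set ℓ
  IsZero V = ∀ v → v ≈ᴹ 0ᴹ
    where open SmoothRep V

  record Hom (V W : SmoothRep) : Set ℓ where
    private
      module V = SmoothRep V
      module W = SmoothRep W
    open LeftModuleMorphisms V.rawLeftModule W.rawLeftModule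
    field
      ⟦_⟧         : V.Carrierᴹ → W.Carrierᴹ
      linear      : IsLeftModuleHomomorphism ⟦_⟧
      equivariant : ∀ g v → ⟦ g V.▷ v ⟧ W.≈ᴹ g W.▷ ⟦ v ⟧

  _≋_ : ∀ {V W} → Hom V W → Hom V W → Set ℓ
  _≋_ {W = W} f f′ = ∀ v → Hom.⟦ f ⟧ v ≈ᴹ Hom.⟦ f′ ⟧ v
    where open SmoothRep W

  _⊚_ : ∀ {U V W} → Hom V W → Hom U V → Hom U W
  _⊚_ {W = W} f e = record
    { ⟦_⟧         = f.⟦_⟧ ∘′ e.⟦_⟧
    ; linear      = ModComp.isLeftModuleHomomorphism W.≈ᴹ-trans e.linear f.linear
    ; equivariant = λ g v → W.≈ᴹ-trans
        (LeftModuleMorphisms.IsLeftModuleHomomorphism.⟦⟧-cong f.linear (e.equivariant g v))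
        (f.equivariant g e.⟦ v ⟧)
    }
    where
    module W = SmoothRep W
    module f = Hom f
    module e = Hom e

  IsEpi : ∀ {V W} → Hom V W → Set (suc ℓ)
  IsEpi {W = W} e = ∀ {Z} (f f′ : Hom W Z) → (f ⊚ e) ≋ (f′ ⊚ e) → f ≋ f′

  IsProjective : SmoothRep → Set (suc ℓ)
  IsProjective P = ∀ {V W} (e : Hom V W) → IsEpi e → (f : Hom P W) →
                   Σ[ f̃ ∈ Hom P V ] ((e ⊚ f̃) ≋ f)

{-# OPTIONS --safe #-}

-- Let P be projective and w ∈ P, with stabilizer L in K.  For every v ∈ P let
-- H₀ v be the stabilizer of v in K, and shrink it by fairness to an open
-- subgroup H v.  The representation ⨁ᵥ c-Ind χ (from H v · C to G) covers P by
-- [g , v] ↦ g v, so projectivity lifts w to an L-invariant element x.  The part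
-- of x carried by one double coset L g (H v · C) maps to Σ_{k ∈ L/S′} k Z, where
-- S = L ∩ g H₀ C g⁻¹, S′ = L ∩ g H C g⁻¹ and S acts on Z ∈ F · g v by scalars.
-- The subsum over S/S′ vanishes: if S moves Z it is a sum over the values of a
-- nontrivial character, and otherwise it is [S : S′] Z.  The index is a power
-- of p, and it is not 1 once fairness has been applied more than [K : L] times,
-- since a chain of that length remains strict after intersecting with L.
-- Hence w = 0.

module Submission where

open import Defs
open import Algebra.Bundles using (Group; CommutativeMonoid)
import Algebra.Definitions.RawMonoid as RawMonoidDefinitions
open import Algebra.Module.Bundles using (LeftModule)
import Algebra.Module.Morphism.Construct.Identity as Identity
open import Algebra.Module.Morphism.Structures using (module LeftModuleMorphisms)
import Algebra.Module.Properties.LeftModule as LeftModuleProperties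
import Algebra.Properties.CommutativeMonoid.Sum as CommutativeMonoidSum
import Algebra.Properties.CommutativeSemigroup as CommutativeSemigroupProperties
import Algebra.Properties.Group as GroupProperties
import Algebra.Properties.Ring as RingProperties
import Algebra.Properties.Semiring.Mult as SemiringMult
open import Axiom.ExcludedMiddle using (ExcludedMiddle)
open import Data.Bool.Base using (Bool; true; false; not)
open import Data.Fin.Base using (Fin; zero; suc; toℕ; punchIn)
import Data.Fin.Properties as Fin
open import Data.List.Base as List using (List; []; _∷_; _++_; length)
open import Data.List.Relation.Unary.Any as Any using (Any; here; there)
import Data.List.Relation.Unary.Any.Properties as Any
open import Data.Nat.Base as ℕ using (ℕ; zero; suc; _^_; _≤_; _<_; _>_; z≤n)
open import Data.Nat.Coprimality using (Coprime; coprime-divisor)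
open import Data.Nat.Divisibility using (_∣_; _∣?_; divides; ∣-trans; ∣-antisym; ∣1⇒≡1)
open import Data.Nat.Primality using (Prime; prime⇒irreducible; irreducible⇒prime)
import Data.Nat.Properties as ℕ
open import Data.Product.Base using (Σ; Σ-syntax; ∃-syntax; _×_; _,_; proj₁; proj₂)
open import Data.Sum.Base using (_⊎_; inj₁; inj₂)
open import Data.Unit.Polymorphic.Base using (⊤; tt)
open import Data.Vec.Base using (Vec; lookup)
open import Data.Vec.Functional using (Vector)
open import Function.Base using (_∘_; id)
open import Function.Bundles using (Inverse; module Equivalence)
open import Level as Level using (Level)
open import Relation.Binary.Bundles using (Setoid)
open import Relation.Binary.PropositionalEquality as ≡ using (_≡_) renaming (setoid to ≡-setoid)
import Relation.Binary.Reasoning.Setoid as SetoidReasoning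
import Relation.Binary.Reflection as Reflection
open import Relation.Binary.Structures using (IsEquivalence)
open import Relation.Nullary.Decidable using (Dec; yes; no)
open import Relation.Nullary.Negation using (¬_; contradiction)
open import Relation.Unary using (Pred; _⊆_; _∩_)

-- Fairness compares subgroups inside `K`, whereas a lift of `w` is invariant only under `L`, and
-- one strict inclusion in `K` can become an equality after intersecting with `L`. This forces the
-- iteration, and it forces the cover to depend on `w`, because the number of iterations is dictated
-- by the cosets of `L`. The factor `C` enters because `C` acts through `χ`: an element of `S`
-- multiplies `Z` by a scalar that may differ from 1. The split on whether `S` moves `Z` handles
-- these scalars without computing `χ` on elements of `K`. No direct sum over double cosets is
-- formed. The part of `x` carried by a double coset means the pairing of `x` with `ψ` cut off
-- outside that double coset. This is legitimate because the cut-off function still has the required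
-- behaviour under right translation. The index of `S′` in `S` is controlled by an open normal
-- subgroup `N` of `K` inside `S′`: it divides `[K : N]`, which is a power of `p`.

private
  variable
    a b ℓ : Level

-- Deciding identities of free groups.

module GroupSolver (G : Group a ℓ) where
  open Group G
  open GroupProperties G using (⁻¹-anti-homo-∙; ⁻¹-involutive; ε⁻¹≈ε; \\-leftDividesˡ; \\-leftDividesʳ)
  open SetoidReasoning setoid

  infixl 7 _⊕_
  infix 8 ⊖_

  data Expr (n : ℕ) : Set where
    var : Fin n → Expr n
    ∅   : Expr n
    _⊕_ : Expr n → Expr n → Expr n
    ⊖_  : Expr n → Expr n

  Word : ℕ → Set
  Word n = List (Bool × Fin n)

  ⟦_⟧ : ∀ {n} → Expr n → Vec Carrier n → Carrier
  ⟦ var i ⟧ ρ = lookup ρ i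
  ⟦ ∅ ⟧ ρ = ε
  ⟦ e ⊕ e′ ⟧ ρ = ⟦ e ⟧ ρ ∙ ⟦ e′ ⟧ ρ
  ⟦ ⊖ e ⟧ ρ = ⟦ e ⟧ ρ ⁻¹

  signed : Bool → Carrier → Carrier
  signed true  x = x
  signed false x = x ⁻¹

  ⟦_⟧ʷ : ∀ {n} → Word n → Vec Carrier n → Carrier
  ⟦ [] ⟧ʷ ρ = ε
  ⟦ (s , i) ∷ w ⟧ʷ ρ = signed s (lookup ρ i) ∙ ⟦ w ⟧ʷ ρ

  push : ∀ {n} → Bool → Fin n → Word n → Word n
  push s i [] = (s , i) ∷ []
  push s i ((t , j) ∷ w) with i Fin.≟ j
  push true  i ((true  , j) ∷ w) | yes _ = (true , i) ∷ (true , j) ∷ w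
  push true  i ((false , j) ∷ w) | yes _ = w
  push false i ((true  , j) ∷ w) | yes _ = w
  push false i ((false , j) ∷ w) | yes _ = (false , i) ∷ (false , j) ∷ w
  push s     i ((t     , j) ∷ w) | no  _ = (s , i) ∷ (t , j) ∷ w

  -- The accumulator stays freely reduced, since a new letter can cancel only against its head.
  -- Expressions that agree in the free group therefore reach the same word. The sign carries
  -- inverses down to the leaves.
  act : ∀ {n} → Bool → Expr n → Word n → Word n
  act s     (var i)  w = push s i w
  act s     ∅        w = w
  act true  (e ⊕ e′) w = act true e (act true e′ w)
  act false (e ⊕ e′) w = act false e′ (act false e w)
  act s     (⊖ e)    w = act (not s) e w

  push-correct : ∀ {n} s (i : Fin n) w ρ →
                 ⟦ push s i w ⟧ʷ ρ ≈ signed s (lookup ρ i) ∙ ⟦ w ⟧ʷ ρ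
  push-correct s i [] ρ = refl
  push-correct s i ((t , j) ∷ w) ρ with i Fin.≟ j
  push-correct true  i ((true  , j) ∷ w) ρ | yes _ = refl
  push-correct true  i ((false , _) ∷ w) ρ | yes ≡.refl = sym (\\-leftDividesˡ _ _)
  push-correct false i ((true  , _) ∷ w) ρ | yes ≡.refl = sym (\\-leftDividesʳ _ _)
  push-correct false i ((false , j) ∷ w) ρ | yes _ = refl
  push-correct s     i ((t     , j) ∷ w) ρ | no _ = refl

  act-correct : ∀ {n} s (e : Expr n) w ρ → ⟦ act s e w ⟧ʷ ρ ≈ signed s (⟦ e ⟧ ρ) ∙ ⟦ w ⟧ʷ ρ
  act-correct s     (var i)  w ρ = push-correct s i w ρ
  act-correct true  ∅        w ρ = sym (identityˡ _)
  act-correct false ∅        w ρ = sym (trans (∙-congʳ ε⁻¹≈ε) (identityˡ _))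
  act-correct true  (e ⊕ e′) w ρ = begin
    ⟦ act true e (act true e′ w) ⟧ʷ ρ       ≈⟨ act-correct true e _ ρ ⟩
    ⟦ e ⟧ ρ ∙ ⟦ act true e′ w ⟧ʷ ρ          ≈⟨ ∙-congˡ (act-correct true e′ w ρ) ⟩
    ⟦ e ⟧ ρ ∙ (⟦ e′ ⟧ ρ ∙ ⟦ w ⟧ʷ ρ)         ≈⟨ assoc _ _ _ ⟨
    ⟦ e ⟧ ρ ∙ ⟦ e′ ⟧ ρ ∙ ⟦ w ⟧ʷ ρ           ∎
  act-correct false (e ⊕ e′) w ρ = begin
    ⟦ act false e′ (act false e w) ⟧ʷ ρ        ≈⟨ act-correct false e′ _ ρ ⟩
    ⟦ e′ ⟧ ρ ⁻¹ ∙ ⟦ act false e w ⟧ʷ ρ         ≈⟨ ∙-congˡ (act-correct false e w ρ) ⟩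
    ⟦ e′ ⟧ ρ ⁻¹ ∙ (⟦ e ⟧ ρ ⁻¹ ∙ ⟦ w ⟧ʷ ρ)      ≈⟨ assoc _ _ _ ⟨
    ⟦ e′ ⟧ ρ ⁻¹ ∙ ⟦ e ⟧ ρ ⁻¹ ∙ ⟦ w ⟧ʷ ρ        ≈⟨ ∙-congʳ (⁻¹-anti-homo-∙ _ _) ⟨
    (⟦ e ⟧ ρ ∙ ⟦ e′ ⟧ ρ) ⁻¹ ∙ ⟦ w ⟧ʷ ρ         ∎
  act-correct true  (⊖ e)    w ρ = act-correct false e w ρ
  act-correct false (⊖ e)    w ρ = trans (act-correct true e w ρ) (∙-congʳ (sym (⁻¹-involutive _)))

  ⟦_⇓⟧ : ∀ {n} → Expr n → Vec Carrier n → Carrier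
  ⟦ e ⇓⟧ ρ = ⟦ act true e [] ⟧ʷ ρ

  correct : ∀ {n} (e : Expr n) ρ → ⟦ e ⇓⟧ ρ ≈ ⟦ e ⟧ ρ
  correct e ρ = trans (act-correct true e [] ρ) (identityʳ _)

  open Reflection setoid var ⟦_⟧ ⟦_⇓⟧ correct public using (solve; _⊜_)

-- Finite sums and coset representatives

module FiniteSums (M : CommutativeMonoid a ℓ) where
  open CommutativeMonoid M renaming (_∙_ to _+_; ε to 0#; identityʳ to +-identityʳ; ∙-cong to +-cong)
  open CommutativeMonoidSum M public
  open SetoidReasoning setoid

  private
    variable
      p q : Level
      P : Set p
      Q : Set q
      n : ℕ

  when : Dec P → Carrier → Carrier
  when (yes _) x = x
  when (no _)  _ = 0#

  when-cong : (d : Dec P) (d′ : Dec Q) → (P → Q) → (Q → P) → ∀ {x y} → (P → x ≈ y) →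
              when d x ≈ when d′ y
  when-cong (yes p) (yes q) _  _  e = e p
  when-cong (yes p) (no ¬q) to _  _ = contradiction (to p) ¬q
  when-cong (no ¬p) (yes q) _  fr _ = contradiction (fr q) ¬p
  when-cong (no _)  (no _)  _  _  _ = refl

  when-yes : (d : Dec P) → P → ∀ {x} → when d x ≈ x
  when-yes (yes _) _ = refl
  when-yes (no ¬p) p = contradiction p ¬p

  when-no : (d : Dec P) → ¬ P → ∀ {x} → when d x ≈ 0#
  when-no (yes p) ¬p = contradiction p ¬p
  when-no (no _)  _  = refl

  ∑-zero : (t : Vector Carrier n) → (∀ i → t i ≈ 0#) → sum t ≈ 0#
  ∑-zero {n} t t≈0 = trans (sum-cong-≋ t≈0) (sum-replicate-zero n)

  ∑-single : (t : Vector Carrier n) (i : Fin n) → (∀ j → ¬ i ≡ j → t j ≈ 0#) → sum t ≈ t i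
  ∑-single {suc _} t i t≈0 = begin
    sum t                               ≈⟨ sum-remove t ⟩
    t i + sum (λ j → t (punchIn i j))   ≈⟨ +-cong refl (∑-zero (λ j → t (punchIn i j)) λ j → t≈0 _ (i≢ j)) ⟩
    t i + 0#                            ≈⟨ +-identityʳ _ ⟩
    t i                                 ∎
    where
    i≢ : ∀ j → ¬ i ≡ punchIn i j
    i≢ j e = Fin.punchInᵢ≢i i j (≡.sym e)

module Cosets (em : ExcludedMiddle ℓ) (G : Group ℓ ℓ) where
  open Group G
  open GroupSolver G using (solve; _⊜_; _⊕_; ⊖_; ∅)

  infix 4 _∼[_]_
  _∼[_]_ : Carrier → Subgroup G → Carrier → Set ℓ
  x ∼[ A ] y = ⌞ A ⌟ (x ⁻¹ ∙ y)

  record IsTransversal (B A : Subgroup G) {n : ℕ} (t : Fin n → Carrier) : Set ℓ where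
    field
      member    : ∀ i → ⌞ B ⌟ (t i)
      cover     : ∀ {b} → ⌞ B ⌟ b → ∃[ i ] b ∼[ A ] t i
      injective : ∀ {i j} → t i ∼[ A ] t j → i ≡ j

  module _ (B A : Subgroup G) where
    private module ∼ = Setoid (cosets G A)

    -- The listed representatives need not lie in `B`. A coset is kept only if it contains an
    -- element of `B` not yet covered, and that element becomes its representative. One list for a
    -- large group thus serves all of its subgroups.
    thin : ∀ {n} (c : Fin n → Carrier) →
           ∃[ m ] Σ[ t ∈ (Fin m → Carrier) ]
             ((∀ i → ⌞ B ⌟ (t i)) × (∀ {i j} → t i ∼[ A ] t j → i ≡ j) ×
              (∀ {b} → ⌞ B ⌟ b → (∃[ i ] b ∼[ A ] c i) → ∃[ i ] b ∼[ A ] t i))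
    thin {zero}  c = 0 , (λ ()) , (λ ()) , (λ { {()} }) , λ { _ (() , _) }
    thin {suc n} c with thin (λ i → c (suc i))
    ... | m , t , t∈B , inj , cov with em {∃[ b ] (⌞ B ⌟ b × b ∼[ A ] c zero × ¬ (∃[ i ] b ∼[ A ] t i))}
    ... | no ¬new = m , t , t∈B , inj , cov′
      where
      cov′ : ∀ {b} → ⌞ B ⌟ b → (∃[ i ] b ∼[ A ] c i) → ∃[ i ] b ∼[ A ] t i
      cov′     b∈B (suc i , b∼c) = cov b∈B (i , b∼c)
      cov′ {b} b∈B (zero  , b∼c) with em {∃[ i ] b ∼[ A ] t i}
      ... | yes p = p
      ... | no ¬p = contradiction (b , b∈B , b∼c , ¬p) ¬new
    ... | yes (b₀ , b₀∈B , b₀∼c , b₀≁t) = suc m , t′ , t′∈B , inj′ , cov′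
      where
      t′ : Fin (suc m) → Carrier
      t′ zero    = b₀
      t′ (suc i) = t i

      t′∈B : ∀ i → ⌞ B ⌟ (t′ i)
      t′∈B zero    = b₀∈B
      t′∈B (suc i) = t∈B i

      inj′ : ∀ {i j} → t′ i ∼[ A ] t′ j → i ≡ j
      inj′ {zero}  {zero}  _   = ≡.refl
      inj′ {zero}  {suc j} b∼t = contradiction (j , b∼t) b₀≁t
      inj′ {suc i} {zero}  t∼b = contradiction (i , ∼.sym {t i} {b₀} t∼b) b₀≁t
      inj′ {suc i} {suc j} t∼t = ≡.cong suc (inj t∼t)

      cov′ : ∀ {b} → ⌞ B ⌟ b → (∃[ i ] b ∼[ A ] c i) → ∃[ i ] b ∼[ A ] t′ i
      cov′ {b} _   (zero  , b∼c) = zero , ∼.trans {b} {c zero} {b₀} b∼c (∼.sym {b₀} {c zero} b₀∼c)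
      cov′ {b} b∈B (suc i , b∼c) with cov b∈B (i , b∼c)
      ... | j , b∼t = suc j , b∼t

    transversal : ∀ {n} (c : Fin n → Carrier) → (∀ {b} → ⌞ B ⌟ b → ∃[ i ] b ∼[ A ] c i) →
                  ∃[ m ] Σ[ t ∈ (Fin m → Carrier) ] IsTransversal B A t
    transversal c covers with thin c
    ... | m , t , t∈B , inj , cov = m , t , record
      { member = t∈B ; cover = λ b∈B → cov b∈B (covers b∈B) ; injective = inj }

  one-coset : ∀ B A {n} {t : Fin n → Carrier} → IsTransversal B A t → n ≡ 1 → ⌞ B ⌟ ⊆ ⌞ A ⌟
  one-coset B A T ≡.refl {b} b∈B with IsTransversal.cover T b∈B | IsTransversal.cover T (Subgroup.ε-closed B)
  ... | zero , b∼t | zero , ε∼t = A.resp-≈ (solve 2 (λ b t → (⊖ ∅ ⊕ t) ⊕ ⊖ (⊖ b ⊕ t) ⊜ b) refl b _)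
    (A.∙-closed ε∼t (A.⁻¹-closed b∼t))
    where
    module A = Subgroup A

  singleton-transversal : ∀ {B} {s} → ⌞ B ⌟ s → IsTransversal B B {1} (λ _ → s)
  singleton-transversal {B} s∈B = record
    { member    = λ _ → s∈B
    ; cover     = λ b∈B → zero , Subgroup.∙-closed B (Subgroup.⁻¹-closed B b∈B) s∈B
    ; injective = λ { {zero} {zero} _ → ≡.refl }
    }

  module _ (M : CommutativeMonoid a b) where
    private module M = CommutativeMonoid M
    open FiniteSums M
    open SetoidReasoning M.setoid

    -- Double counting in place of a bijection of index sets: in the triple sum over the relation
    -- `P`, each `i` meets exactly one pair `(j , k)` and each pair exactly one `i`, so
    -- interchanging the sums proves the formula.
    ∑-tower : ∀ {B D A : Subgroup G} → ⌞ D ⌟ ⊆ ⌞ B ⌟ → ⌞ A ⌟ ⊆ ⌞ D ⌟ →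
              ∀ {l m n} {t : Fin l → Carrier} {r : Fin m → Carrier} {q : Fin n → Carrier} →
              IsTransversal B A t → IsTransversal B D r → IsTransversal D A q →
              (f : Carrier → M.Carrier) → (∀ {x y} → ⌞ B ⌟ x → x ∼[ A ] y → f x M.≈ f y) →
              sum (λ i → f (t i)) M.≈ sum (λ j → sum (λ k → f (r j ∙ q k)))
    ∑-tower {B} {D} {A} D⊆B A⊆D {l} {m} {n} {t} {r} {q} T R Q f f-resp = begin
      sum (λ i → f (t i))
        ≈⟨ sum-cong-≋ (λ i → M.sym (collapse i)) ⟩
      sum (λ i → sum (λ j → sum (λ k → when (em {P i j k}) (f (t i)))))
        ≈⟨ ∑-comm {l} {m} _ ⟩
      sum (λ j → sum (λ i → sum (λ k → when (em {P i j k}) (f (t i)))))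
        ≈⟨ sum-cong-≋ {m} (λ j → ∑-comm {l} {n} _) ⟩
      sum (λ j → sum (λ k → sum (λ i → when (em {P i j k}) (f (t i)))))
        ≈⟨ sum-cong-≋ {m} (λ j → sum-cong-≋ {n} (λ k → collapse′ j k)) ⟩
      sum (λ j → sum (λ k → f (r j ∙ q k))) ∎
      where
      module A = Subgroup A
      module B = Subgroup B
      module D = Subgroup D
      module T = IsTransversal T
      module R = IsTransversal R
      module Q = IsTransversal Q
      module ∼ = Setoid (cosets G A)

      P : Fin l → Fin m → Fin n → Set ℓ
      P i j k = t i ∼[ A ] (r j ∙ q k)

      collapse : ∀ i → sum (λ j → sum (λ k → when (em {P i j k}) (f (t i)))) M.≈ f (t i)
      collapse i with R.cover (T.member i)
      ... | j , t∼r with Q.cover (D.resp-≈ (solve 2 (λ t r → ⊖ (⊖ t ⊕ r) ⊜ ⊖ r ⊕ t) refl (t i) (r j)) (D.⁻¹-closed t∼r))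
      ... | k , rt∼q = begin
        sum (λ j → sum (λ k → when (em {P i j k}) (f (t i))))
          ≈⟨ ∑-single {m} _ j (λ j′ j≢ → ∑-zero {n} _ λ k′ → when-no em (λ p → j≢ (unique p))) ⟩
        sum (λ k → when (em {P i j k}) (f (t i)))
          ≈⟨ ∑-single {n} _ k (λ k′ k≢ → when-no em (λ p → k≢ (unique′ p))) ⟩
        when (em {P i j k}) (f (t i))
          ≈⟨ when-yes em tie ⟩
        f (t i) ∎
        where
        tie : P i j k
        tie = A.resp-≈ (solve 3 (λ t r q → ⊖ (⊖ r ⊕ t) ⊕ q ⊜ ⊖ t ⊕ (r ⊕ q)) refl (t i) (r j) (q k)) rt∼q
        unique : ∀ {j′ k′} → P i j′ k′ → j ≡ j′
        unique {j′} {k′} p = R.injective (D.resp-≈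
          (solve 4 (λ t r r′ q′ → ⊖ (⊖ t ⊕ r) ⊕ (⊖ t ⊕ (r′ ⊕ q′) ⊕ ⊖ q′) ⊜ ⊖ r ⊕ r′) refl (t i) (r j) (r j′) (q k′))
          (D.∙-closed (D.⁻¹-closed t∼r) (D.∙-closed (A⊆D p) (D.⁻¹-closed (Q.member k′)))))
        unique′ : ∀ {k′} → P i j k′ → k ≡ k′
        unique′ {k′} p = Q.injective (A.resp-≈
          (solve 4 (λ t r q q′ → ⊖ (⊖ t ⊕ (r ⊕ q)) ⊕ (⊖ t ⊕ (r ⊕ q′)) ⊜ ⊖ q ⊕ q′) refl (t i) (r j) (q k) (q k′))
          (A.∙-closed (A.⁻¹-closed tie) p))

      collapse′ : ∀ j k → sum (λ i → when (em {P i j k}) (f (t i))) M.≈ f (r j ∙ q k)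
      collapse′ j k with T.cover (B.∙-closed (R.member j) (D⊆B (Q.member k)))
      ... | i , rq∼t = begin
        sum (λ i → when (em {P i j k}) (f (t i)))
          ≈⟨ ∑-single {l} _ i (λ i′ i≢ → when-no em (λ p → i≢ (T.injective
               (∼.trans {t i} {r j ∙ q k} {t i′} t∼rq (∼.sym {t i′} {r j ∙ q k} p))))) ⟩
        when (em {P i j k}) (f (t i))
          ≈⟨ when-yes em t∼rq ⟩
        f (t i)
          ≈⟨ f-resp (T.member i) t∼rq ⟩
        f (r j ∙ q k) ∎
        where
        t∼rq : t i ∼[ A ] (r j ∙ q k)
        t∼rq = ∼.sym {r j ∙ q k} {t i} rq∼t

    -- This is the tower formula with `D = B`, where `s` alone is a transversal of `B` modulo
    -- itself.
    ∑-translate : ∀ {B A : Subgroup G} → ⌞ A ⌟ ⊆ ⌞ B ⌟ → ∀ {n} {t : Fin n → Carrier} →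
                  IsTransversal B A t → (f : Carrier → M.Carrier) →
                  (∀ {x y} → ⌞ B ⌟ x → x ∼[ A ] y → f x M.≈ f y) →
                  ∀ {s} → ⌞ B ⌟ s → sum (λ i → f (t i)) M.≈ sum (λ i → f (s ∙ t i))
    ∑-translate A⊆B T f f-resp s∈B =
      M.trans (∑-tower (λ b → b) A⊆B T (singleton-transversal s∈B) T f f-resp) (M.identityʳ _)

-- Open subgroups and their indices

module OpenSubgroups (G : TopologicalGroup ℓ) where
  open TopologicalGroup G
  open GroupSolver group using (solve; _⊜_; _⊕_; ⊖_; ∅)
  open GroupProperties group using (\\-leftDividesˡ)

  -- Continuity of the product gives a rectangle around each `(g , x)`; the union of the second
  -- sides, indexed by the points `x` themselves, is the set in question.
  open-translateˡ : ∀ {U} → IsOpen U → ∀ g → IsOpen (λ x → U (g ∙ x))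
  open-translateˡ {U} oU g = open-resp-≐
    ((λ { ((x , u) , w) → proj₂ (proj₂ (nbhd u)) w }) , (λ {x} u → (x , u) , proj₁ (proj₂ (nbhd u))))
    (open-⋃ {I = Σ Carrier (λ x → U (g ∙ x))} {U = λ { (x , u) → W u }} (λ { (x , u) → proj₁ (nbhd u) }))
    where
    W : ∀ {x} → U (g ∙ x) → Pred Carrier ℓ
    W u = let (V , W , _) = ∙-continuous oU u in W

    nbhd : ∀ {x} (u : U (g ∙ x)) → IsOpen (W u) × W u x × (∀ {y} → W u y → U (g ∙ y))
    nbhd u = let (V , W , oV , oW , v , w , VW⊆U) = ∙-continuous oU u in oW , w , VW⊆U v

  open-translateʳ : ∀ {U} → IsOpen U → ∀ g → IsOpen (λ x → U (x ∙ g))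
  open-translateʳ {U} oU g = open-resp-≐
    ((λ { ((x , u) , v) → proj₂ (proj₂ (nbhd u)) v }) , (λ {x} u → (x , u) , proj₁ (proj₂ (nbhd u))))
    (open-⋃ {I = Σ Carrier (λ x → U (x ∙ g))} {U = λ { (x , u) → V u }} (λ { (x , u) → proj₁ (nbhd u) }))
    where
    V : ∀ {x} → U (x ∙ g) → Pred Carrier ℓ
    V u = let (V , W , _) = ∙-continuous oU u in V

    nbhd : ∀ {x} (u : U (x ∙ g)) → IsOpen (V u) × V u x × (∀ {y} → V u y → U (y ∙ g))
    nbhd u = let (V , W , oV , oW , v , w , VW⊆U) = ∙-continuous oU u in oV , v , λ v′ → VW⊆U v′ w

  open-conjugate : ∀ {U} → IsOpen U → ∀ g → IsOpen (λ x → U (g ⁻¹ ∙ x ∙ g))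
  open-conjugate oU g = open-translateˡ (open-translateʳ oU g) (g ⁻¹)

  open-⋂ : ∀ {n} {U : Fin n → Pred Carrier ℓ} → (∀ i → IsOpen (U i)) → IsOpen (λ x → ∀ i → U i x)
  open-⋂ {zero}  oU = open-resp-≐ ((λ _ ()) , (λ _ → tt)) open-⊤
  open-⋂ {suc n} oU = open-resp-≐
    ((λ { (u , us) zero → u ; (u , us) (suc i) → us i }) , (λ us → us zero , us ∘ suc))
    (open-∩ (oU zero) (open-⋂ (oU ∘ suc)))

  open-subgroup : (S : Subgroup group) → ∀ {U} → IsOpen U → U ε → U ⊆ ⌞ S ⌟ → IsOpen ⌞ S ⌟
  open-subgroup S {U} oU uε U⊆S = open-resp-≐
    ( (λ { ((x , x∈S) , u) → S.resp-≈ (\\-leftDividesˡ _ _) (S.∙-closed x∈S (U⊆S u)) })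
    , (λ {x} x∈S → (x , x∈S) , open-resp-≈ oU (sym (inverseˡ x)) uε))
    (open-⋃ {I = Σ Carrier ⌞ S ⌟} {U = λ { (x , _) y → U (x ⁻¹ ∙ y) }} λ { (x , _) → open-translateˡ oU (x ⁻¹) })
    where
    module S = Subgroup S

  infixl 7 _⊓_
  _⊓_ : Subgroup group → Subgroup group → Subgroup group
  A ⊓ B = record
    { ⌞_⌟       = λ x → ⌞ A ⌟ x × ⌞ B ⌟ x
    ; resp-≈    = λ { x≈y (a , b) → A.resp-≈ x≈y a , B.resp-≈ x≈y b }
    ; ε-closed  = A.ε-closed , B.ε-closed
    ; ∙-closed  = λ { (a , b) (a′ , b′) → A.∙-closed a a′ , B.∙-closed b b′ }
    ; ⁻¹-closed = λ { (a , b) → A.⁻¹-closed a , B.⁻¹-closed b }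
    }
    where
    module A = Subgroup A
    module B = Subgroup B

  infix 8 _^ᶜ_
  -- The conjugate `g A g⁻¹`, written as a preimage so that membership carries no existential,
  -- unlike `conjugate`.
  _^ᶜ_ : Subgroup group → Carrier → Subgroup group
  A ^ᶜ g = record
    { ⌞_⌟       = λ x → ⌞ A ⌟ (g ⁻¹ ∙ x ∙ g)
    ; resp-≈    = λ x≈y → A.resp-≈ (∙-congʳ (∙-congˡ x≈y))
    ; ε-closed  = A.resp-≈ (solve 1 (λ g → ∅ ⊜ ⊖ g ⊕ ∅ ⊕ g) refl g) A.ε-closed
    ; ∙-closed  = λ {x} {y} a b → A.resp-≈
        (solve 3 (λ g x y → (⊖ g ⊕ x ⊕ g) ⊕ (⊖ g ⊕ y ⊕ g) ⊜ ⊖ g ⊕ (x ⊕ y) ⊕ g) refl g x y) (A.∙-closed a b)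
    ; ⁻¹-closed = λ {x} a → A.resp-≈
        (solve 2 (λ g x → ⊖ (⊖ g ⊕ x ⊕ g) ⊜ ⊖ g ⊕ ⊖ x ⊕ g) refl g x) (A.⁻¹-closed a)
    }
    where
    module A = Subgroup A

  module _ (em : ExcludedMiddle ℓ) where
    open Cosets em group

    module _ {K : Subgroup group} (compact : TopologicalGroup.IsCompact (subgroupᵗ G K)) where
      private module K = Subgroup K

      finite-cover : (A : Subgroup group) → IsOpen ⌞ A ⌟ →
                     ∃[ n ] Σ[ c ∈ (Fin n → Carrier) ] ((∀ i → ⌞ K ⌟ (c i)) × (∀ {k} → ⌞ K ⌟ k → ∃[ i ] k ∼[ A ] c i))
      finite-cover A oA with compact {I = Σ Carrier ⌞ K ⌟} (λ { (k , _) (x , _) → k ∼[ A ] x })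
                               (λ { (k , _) → (λ x → k ∼[ A ] x) , open-translateˡ oA (k ⁻¹) , id , id })
                               (λ { (k , k∈K) → (k , k∈K) , ∼.refl {k} })
        where
        module ∼ = Setoid (cosets group A)
      ... | ks , covers = length ks , proj₁ ∘ List.lookup ks , proj₂ ∘ List.lookup ks , λ {k} k∈K →
        let i = Any.index (covers (k , k∈K)) in
        i , ∼.sym {proj₁ (List.lookup ks i)} (Any.lookup-index (covers (k , k∈K)))
        where
        module ∼ = Setoid (cosets group A)

      -- The normal core in `K`. `IsProP` gives orders only of quotients by open normal subgroups,
      -- so other indices are measured against such a core.
      core : (A : Subgroup group) → Subgroup group
      core A = record
        { ⌞_⌟       = λ x → ⌞ K ⌟ x × (∀ {k} → ⌞ K ⌟ k → ⌞ A ^ᶜ k ⌟ x)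
        ; resp-≈    = λ { x≈y (x∈K , x∈A) → K.resp-≈ x≈y x∈K , λ {k} k∈K → Subgroup.resp-≈ (A ^ᶜ k) x≈y (x∈A k∈K) }
        ; ε-closed  = K.ε-closed , λ {k} _ → Subgroup.ε-closed (A ^ᶜ k)
        ; ∙-closed  = λ { (x∈K , x∈A) (y∈K , y∈A) →
            K.∙-closed x∈K y∈K , λ {k} k∈K → Subgroup.∙-closed (A ^ᶜ k) (x∈A k∈K) (y∈A k∈K) }
        ; ⁻¹-closed = λ { (x∈K , x∈A) → K.⁻¹-closed x∈K , λ {k} k∈K → Subgroup.⁻¹-closed (A ^ᶜ k) (x∈A k∈K) }
        }

      core-⊆ : ∀ A → ⌞ core A ⌟ ⊆ ⌞ A ⌟
      core-⊆ A {x} (_ , x∈A) = Subgroup.resp-≈ A (solve 1 (λ x → ⊖ ∅ ⊕ x ⊕ ∅ ⊜ x) refl x) (x∈A K.ε-closed)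

      core-normal : ∀ A {k x} → ⌞ K ⌟ k → ⌞ core A ⌟ x → ⌞ core A ⌟ (k ∙ x ∙ k ⁻¹)
      core-normal A {k} {x} k∈K (x∈K , x∈A) = K.∙-closed (K.∙-closed k∈K x∈K) (K.⁻¹-closed k∈K) , λ {h} h∈K →
        Subgroup.resp-≈ A (solve 3 (λ k x h → ⊖ (⊖ k ⊕ h) ⊕ x ⊕ (⊖ k ⊕ h) ⊜ ⊖ h ⊕ (k ⊕ x ⊕ ⊖ k) ⊕ h) refl k x h)
          (x∈A (K.∙-closed (K.⁻¹-closed k∈K) h∈K))

      -- The conjugate `k A k⁻¹` depends only on the coset `k A`, so by compactness the intersection
      -- over `K` is a finite one.
      core-open : IsOpen ⌞ K ⌟ → ∀ A → IsOpen ⌞ A ⌟ → IsOpen ⌞ core A ⌟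
      core-open oK A oA with finite-cover A oA
      ... | n , c , c∈K , covers = open-resp-≐
        ( (λ { {x} (x∈K , x∈A) → x∈K , λ {k} k∈K → let (i , k∼c) = covers k∈K in
               A.resp-≈ (solve 3 (λ k x c → (⊖ k ⊕ c) ⊕ (⊖ c ⊕ x ⊕ c) ⊕ ⊖ (⊖ k ⊕ c) ⊜ ⊖ k ⊕ x ⊕ k) refl k x (c i))
                 (A.∙-closed (A.∙-closed k∼c (x∈A i)) (A.⁻¹-closed k∼c)) })
        , (λ { (x∈K , x∈A) → x∈K , λ i → x∈A (c∈K i) }))
        (open-∩ oK (open-⋂ λ i → open-conjugate oA (c i)))
        where
        module A = Subgroup A

    module _ {p} {K : Subgroup group} (oK : IsOpen ⌞ K ⌟) (proP : IsProP p (subgroupᵗ G K)) where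
      open IsProP proP using (compact; quotients)
      private module K = Subgroup K

      asSubgroupOfK : Subgroup group → Subgroup (subgroup K)
      asSubgroupOfK N = record
        { ⌞_⌟       = ⌞ N ⌟ ∘ proj₁
        ; resp-≈    = Subgroup.resp-≈ N
        ; ε-closed  = Subgroup.ε-closed N
        ; ∙-closed  = Subgroup.∙-closed N
        ; ⁻¹-closed = Subgroup.⁻¹-closed N
        }

      enumeration-transversal : ∀ N {m} (I : Inverse (≡-setoid (Fin m)) (cosets (subgroup K) (asSubgroupOfK N))) →
                                IsTransversal K N (proj₁ ∘ Inverse.to I)
      enumeration-transversal N I = record
        { member    = proj₂ ∘ I.to
        ; cover     = λ {k} k∈K → I.from (k , k∈K) , ∼.sym {proj₁ (I.to (I.from (k , k∈K)))} {k} (I.inverseˡ ≡.refl)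
        ; injective = λ {i} {j} e → ≡.trans (≡.sym (I.inverseʳ {i} (∼.refl {proj₁ (I.to i)}))) (I.inverseʳ {j} {I.to i} e)
        }
        where
        module I = Inverse I
        module ∼ = Setoid (cosets group N)

      core-transversal : (A : Subgroup group) → IsOpen ⌞ A ⌟ →
                         ∃[ n ] Σ[ t ∈ (Fin (p ^ n) → Carrier) ] IsTransversal K (core {K} compact A) t
      core-transversal A oA with quotients (asSubgroupOfK (core {K} compact A))
                                   (⌞ core {K} compact A ⌟ , core-open {K} compact oK A oA , id , id)
                                   (λ { (k , k∈K) {x , _} → core-normal {K} compact A {k} {x} k∈K })
      ... | n , I = n , proj₁ ∘ Inverse.to I , enumeration-transversal (core {K} compact A) I

    -- Multiplicativity of the index is `∑-tower` for the constant function 1 with values in the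
    -- natural numbers.
    index-tower : ∀ {B D A : Subgroup group} → ⌞ D ⌟ ⊆ ⌞ B ⌟ → ⌞ A ⌟ ⊆ ⌞ D ⌟ →
                  ∀ {l m n} {t : Fin l → Carrier} {r : Fin m → Carrier} {q : Fin n → Carrier} →
                  IsTransversal B A t → IsTransversal B D r → IsTransversal D A q → l ≡ m ℕ.* n
    index-tower D⊆B A⊆D {l} {m} {n} T R Q = begin
      l                                           ≡⟨ sum-1 l ⟨
      sum {l} (λ _ → 1)
        ≡⟨ ∑-tower ℕ.+-0-commutativeMonoid D⊆B A⊆D T R Q (λ _ → 1) (λ _ _ → ≡.refl) ⟩
      sum {m} (λ _ → sum {n} (λ _ → 1))           ≡⟨ sum-const m _ ⟩
      m ℕ.* sum {n} (λ _ → 1)                       ≡⟨ ≡.cong (m ℕ.*_) (sum-1 n) ⟩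
      m ℕ.* n                                       ∎
      where
      open ≡.≡-Reasoning
      open CommutativeMonoidSum ℕ.+-0-commutativeMonoid using (sum)
      sum-const : ∀ k c → sum {k} (λ _ → c) ≡ k ℕ.* c
      sum-const zero    c = ≡.refl
      sum-const (suc k) c = ≡.cong (c ℕ.+_) (sum-const k c)
      sum-1 : ∀ k → sum {k} (λ _ → 1) ≡ k
      sum-1 k = ≡.trans (sum-const k 1) (ℕ.*-identityʳ k)

    -- `S′` may fail to be normal in `S`, so its index is not read off a quotient group but from the
    -- two towers `N ⊆ S ⊆ K` and `N ⊆ S′ ⊆ S`.
    index-divides : ∀ {K S S′ N : Subgroup group} → ⌞ N ⌟ ⊆ ⌞ S′ ⌟ → ⌞ S′ ⌟ ⊆ ⌞ S ⌟ → ⌞ S ⌟ ⊆ ⌞ K ⌟ →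
                    ∀ {l} {tᴷ : Fin l → Carrier} → IsTransversal K N tᴷ →
                    ∀ {m} {t : Fin m → Carrier} → IsTransversal S S′ t → m ∣ l
    index-divides {K} {S} {S′} {N} N⊆S′ S′⊆S S⊆K {l} {tᴷ} Tᴷ {m} T =
      let (r , tᴷˢ , Tᴷˢ) = transversal K S tᴷ (λ k∈K → let (i , e) = IsTransversal.cover Tᴷ k∈K in i , S′⊆S (N⊆S′ e))
          (s , tˢ , Tˢ)   = transversal S N tᴷ (λ s∈S → IsTransversal.cover Tᴷ (S⊆K s∈S))
          (s′ , tˢ′ , Tˢ′) = transversal S′ N tᴷ (λ s∈S → IsTransversal.cover Tᴷ (S⊆K (S′⊆S s∈S)))
      in ∣-trans (divides s′ (≡.trans (index-tower S′⊆S N⊆S′ Tˢ T Tˢ′) (ℕ.*-comm m s′)))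
                 (divides r (index-tower S⊆K (λ x → S′⊆S (N⊆S′ x)) Tᴷ Tᴷˢ Tˢ))

-- Arithmetic of the characteristic.

prime∣divisor-of-power : ∀ {p} → Prime p → ∀ n {d} → d ∣ p ^ n → ¬ d ≡ 1 → p ∣ d
prime∣divisor-of-power {p} pr zero    {d} d∣1 d≢1 = contradiction (∣1⇒≡1 d∣1) d≢1
prime∣divisor-of-power {p} pr (suc n) {d} d∣ d≢1 with p ∣? d
... | yes p∣d = p∣d
... | no p∤d = prime∣divisor-of-power pr n (coprime-divisor coprime d∣) d≢1
  where
  coprime : Coprime d p
  coprime {e} (e∣d , e∣p) with prime⇒irreducible pr e∣p
  ... | inj₁ e≡1 = e≡1
  ... | inj₂ ≡.refl = contradiction e∣d p∤d

-- Primality is derived: in a factorization `p = q d` one factor vanishes in `F`, because a field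
-- has no zero divisors, and the characteristic then divides that factor.
characteristic-prime : ExcludedMiddle ℓ → (F : Field ℓ) → ∀ {p} → p > 0 → HasCharacteristic F p → Prime p
characteristic-prime em F {1} p>0 char =
  contradiction (trans (sym (+-identityʳ 1#)) (Equivalence.from (char 1) (divides 1 ≡.refl))) 1≉0
  where open Field F
characteristic-prime em F {p@(suc (suc _))} p>0 char = irreducible⇒prime irreducible
  where
  open Field F
  open SemiringMult semiring using (×1-homo-*) renaming (_×_ to _·_)
  open SetoidReasoning setoid
  irreducible : ∀ {d} → d ∣ p → d ≡ 1 ⊎ d ≡ p
  irreducible {d} d∣p@(divides q p≡qd) with em {d · 1# ≈ 0#}
  ... | yes d≈0 = inj₂ (∣-antisym d∣p (Equivalence.to (char d) d≈0))
  ... | no d≉0 = inj₁ (ℕ.*-cancelˡ-≡ d 1 p (≡.trans (≡.trans (≡.cong (ℕ._* d) p≡q) (≡.sym p≡qd)) (≡.sym (ℕ.*-identityʳ p))))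
    where
    q∣p : q ∣ p
    q∣p = divides d (≡.trans p≡qd (ℕ.*-comm q d))
    q≈0 : q · 1# ≈ 0#
    q≈0 with invertible d≉0
    ... | b , _ , d*b≈1 = begin
      q · 1#                        ≈⟨ *-identityʳ _ ⟨
      (q · 1#) * 1#                   ≈⟨ *-congˡ d*b≈1 ⟨
      (q · 1#) * ((d · 1#) * b)         ≈⟨ *-assoc _ _ _ ⟨
      (q · 1#) * (d · 1#) * b         ≈⟨ *-congʳ (×1-homo-* q d) ⟨
      ((q ℕ.* d) · 1#) * b            ≈⟨ *-congʳ (reflexive (≡.cong (_· 1#) p≡qd)) ⟨
      (p · 1#) * b                    ≈⟨ *-congʳ (Equivalence.from (char p) (divides 1 (≡.sym (ℕ.*-identityˡ p)))) ⟩
      0# * b                        ≈⟨ zeroˡ b ⟩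
      0#                            ∎
    p≡q : p ≡ q
    p≡q = ∣-antisym (Equivalence.to (char q) q≈0) q∣p

-- Iterated fairness

module CentralProduct (G : TopologicalGroup ℓ) (C : Subgroup (TopologicalGroup.group G)) (central : IsCentral C) where
  open TopologicalGroup G
  open GroupSolver group using (solve; _⊜_; _⊕_; ⊖_)
  open SetoidReasoning setoid
  private module C = Subgroup C

  infix 8 _·C
  _·C : Subgroup group → Subgroup group
  H ·C = record
    { ⌞_⌟       = setProduct group ⌞ H ⌟ ⌞ C ⌟
    ; resp-≈    = λ { x≈y (h , c , h∈H , c∈C , x≈) → h , c , h∈H , c∈C , trans (sym x≈y) x≈ }
    ; ε-closed  = ε , ε , H.ε-closed , C.ε-closed , sym (identityˡ ε)
    ; ∙-closed  = λ { {x} {y} (h , c , h∈H , c∈C , x≈) (h′ , c′ , h′∈H , c′∈C , y≈) →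
        h ∙ h′ , c ∙ c′ , H.∙-closed h∈H h′∈H , C.∙-closed c∈C c′∈C , (begin
          x ∙ y                ≈⟨ ∙-cong x≈ y≈ ⟩
          h ∙ c ∙ (h′ ∙ c′)    ≈⟨ solve 4 (λ h c h′ c′ → h ⊕ c ⊕ (h′ ⊕ c′) ⊜ h ⊕ (c ⊕ h′) ⊕ c′) refl h c h′ c′ ⟩
          h ∙ (c ∙ h′) ∙ c′    ≈⟨ ∙-congʳ (∙-congˡ (central c∈C h′)) ⟩
          h ∙ (h′ ∙ c) ∙ c′    ≈⟨ solve 4 (λ h c h′ c′ → h ⊕ (h′ ⊕ c) ⊕ c′ ⊜ h ⊕ h′ ⊕ (c ⊕ c′)) refl h c h′ c′ ⟩
          h ∙ h′ ∙ (c ∙ c′)    ∎) }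
    ; ⁻¹-closed = λ { {x} (h , c , h∈H , c∈C , x≈) →
        h ⁻¹ , c ⁻¹ , H.⁻¹-closed h∈H , C.⁻¹-closed c∈C , (begin
          x ⁻¹           ≈⟨ ⁻¹-cong (trans x≈ (sym (central c∈C h))) ⟩
          (c ∙ h) ⁻¹     ≈⟨ solve 2 (λ h c → ⊖ (c ⊕ h) ⊜ ⊖ h ⊕ ⊖ c) refl h c ⟩
          h ⁻¹ ∙ c ⁻¹    ∎) }
    }
    where
    module H = Subgroup H

  ·C-mono : ∀ {A B : Subgroup group} → ⌞ A ⌟ ⊆ ⌞ B ⌟ → ⌞ A ·C ⌟ ⊆ ⌞ B ·C ⌟
  ·C-mono A⊆B (h , c , h∈A , c∈C , x≈) = h , c , A⊆B h∈A , c∈C , x≈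

  ⊆·C : ∀ (H : Subgroup group) → ⌞ H ⌟ ⊆ ⌞ H ·C ⌟
  ⊆·C H {h} h∈H = h , ε , h∈H , C.ε-closed , sym (identityʳ h)

  C⊆·C : ∀ (H : Subgroup group) → ⌞ C ⌟ ⊆ ⌞ H ·C ⌟
  C⊆·C H {c} c∈C = ε , c , Subgroup.ε-closed H , c∈C , sym (identityˡ c)

module FairChain (em : ExcludedMiddle ℓ) (G : TopologicalGroup ℓ) (C : Subgroup (TopologicalGroup.group G))
                 (central : IsCentral C) (K : Subgroup (TopologicalGroup.group G)) (fair : IsFair G C K) where
  open TopologicalGroup G
  open GroupSolver group using (solve; _⊜_; _⊕_; ⊖_)
  open OpenSubgroups G
  open Cosets em group
  open CentralProduct G C central

  record OpenIn : Set (Level.suc ℓ) where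
    field
      sub   : Subgroup group
      open′ : IsOpen ⌞ sub ⌟
      ⊆K    : ⌞ sub ⌟ ⊆ ⌞ K ⌟
  open OpenIn public

  -- The subgroup given by fairness is not known to lie in `H`. Intersecting makes the chain
  -- decreasing, and it preserves strictness because only the smaller side shrinks.
  next : OpenIn → OpenIn
  next H = let (H′ , oH′ , H′⊆K , _) = fair (sub H) (open′ H) (⊆K H) in record
    { sub = sub H ⊓ H′ ; open′ = open-∩ (open′ H) oH′ ; ⊆K = ⊆K H ∘ proj₁ }

  -- Strictness in `IsFair` is a negated inclusion; excluded middle extracts the point that the
  -- pigeonhole argument needs.
  next-strict : ∀ H g → ∃[ x ] (⌞ K ⌟ x × ⌞ (sub H ·C) ^ᶜ g ⌟ x × ¬ ⌞ (sub (next H) ·C) ^ᶜ g ⌟ x)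
  next-strict H g with em {∃[ x ] (⌞ K ⌟ x × ⌞ (sub H ·C) ^ᶜ g ⌟ x × ¬ ⌞ (sub (next H) ·C) ^ᶜ g ⌟ x)}
  ... | yes p = p
  ... | no ¬p = let (H′ , oH′ , H′⊆K , strict) = fair (sub H) (open′ H) (⊆K H) in contradiction
    (λ { {x} (x∈K , j , j∈HC , x≈) → x∈K , keep H′ (λ {y} → proj₂) x∈K
           (Subgroup.resp-≈ (sub H ·C)
             (trans (solve 2 (λ g j → j ⊜ ⊖ g ⊕ (g ⊕ j ⊕ ⊖ g) ⊕ g) refl g j) (∙-congʳ (∙-congˡ (sym x≈)))) j∈HC) })
    (proj₂ (strict g))
    where
    keep : ∀ (H′ : Subgroup group) → (∀ {y} → ⌞ sub (next H) ⌟ y → ⌞ H′ ⌟ y) →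
           ∀ {x} → ⌞ K ⌟ x → ⌞ (sub H ·C) ^ᶜ g ⌟ x →
           conjugate group g (setProduct group ⌞ H′ ⌟ ⌞ C ⌟) x
    keep H′ ⊆H′ {x} x∈K x∈HC with em {⌞ (sub (next H) ·C) ^ᶜ g ⌟ x}
    ... | yes x∈ = _ , ·C-mono {sub (next H)} {H′} ⊆H′ x∈ , solve 2 (λ g x → x ⊜ g ⊕ (⊖ g ⊕ x ⊕ g) ⊕ ⊖ g) refl g x
    ... | no x∉  = contradiction (x , x∈K , x∈HC , x∉) ¬p

  chain : OpenIn → ℕ → OpenIn
  chain H zero    = H
  chain H (suc i) = next (chain H i)

  chain-antitone : ∀ H {i j} → i ≤ j → ⌞ sub (chain H j) ⌟ ⊆ ⌞ sub (chain H i) ⌟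
  chain-antitone H i≤j = go (ℕ.≤⇒≤′ i≤j)
    where
    go : ∀ {i j} → i ℕ.≤′ j → ⌞ sub (chain H j) ⌟ ⊆ ⌞ sub (chain H i) ⌟
    go ℕ.≤′-refl       = id
    go (ℕ.≤′-step i≤j) = go i≤j ∘ proj₁

  -- Elements witnessing the n + 1 strict inclusions would be pairwise
  -- incongruent modulo L.
  chain-strict : ∀ H {L : Subgroup group} {n} (c : Fin n → Carrier) →
                 (∀ {k} → ⌞ K ⌟ k → ∃[ i ] k ∼[ L ] c i) → ∀ g →
                 ¬ (∀ {x} → ⌞ L ⌟ x → ⌞ (sub H ·C) ^ᶜ g ⌟ x → ⌞ (sub (chain H (suc n)) ·C) ^ᶜ g ⌟ x)
  chain-strict H {L} {n} c cover g L∩⊆ with Fin.pigeonhole ℕ.≤-refl class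
    where
    class : Fin (suc n) → Fin n
    class i = proj₁ (cover (proj₁ (proj₂ (next-strict (chain H (toℕ i)) g))))
  ... | i , j , i<j , same = proj₂ (proj₂ (proj₂ (next-strict (chain H (toℕ i)) g)))
    -- Two witnesses with `i < j` share an `L`-coset. Their quotient lies in `L` and in `T 0`, hence
    -- by assumption in the last term and so in `T (suc (toℕ i))`. That term also contains `s j`, so
    -- it would contain `s i`, which was chosen outside it.
    (S.resp-≈ (solve 2 (λ x y → y ⊕ ⊖ (⊖ x ⊕ y) ⊜ x) refl (s i) (s j))
      (S.∙-closed (antitone {suc (toℕ i)} {toℕ j} i<j (s∈ j))
        (S.⁻¹-closed (antitone {suc (toℕ i)} {suc n} i<n (L∩⊆ sᵢ∼sⱼ (antitone {0} {toℕ i} z≤n sᵢ⁻¹sⱼ∈))))))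
    where
    module ∼ = Setoid (cosets group L)
    T : ℕ → Subgroup group
    T m = (sub (chain H m) ·C) ^ᶜ g
    module S = Subgroup (T (suc (toℕ i)))
    s : Fin (suc n) → Carrier
    s i = proj₁ (next-strict (chain H (toℕ i)) g)
    s∈ : ∀ i → ⌞ T (toℕ i) ⌟ (s i)
    s∈ i = proj₁ (proj₂ (proj₂ (next-strict (chain H (toℕ i)) g)))
    antitone : ∀ {l m} → l ≤ m → ⌞ T m ⌟ ⊆ ⌞ T l ⌟
    antitone {l} {m} l≤m = ·C-mono {sub (chain H m)} {sub (chain H l)} (chain-antitone H l≤m)
    i<n : toℕ i < suc n
    i<n = Fin.toℕ<n i
    coset : ∀ k → s k ∼[ L ] c _
    coset k = proj₂ (cover (proj₁ (proj₂ (next-strict (chain H (toℕ k)) g))))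
    sᵢ∼sⱼ : s i ∼[ L ] s j
    sᵢ∼sⱼ = ∼.trans {s i} (coset i) (≡.subst (λ m → c m ∼[ L ] s j) (≡.sym same) (∼.sym {s j} (coset j)))
    sᵢ⁻¹sⱼ∈ : ⌞ T (toℕ i) ⌟ (s i ⁻¹ ∙ s j)
    sᵢ⁻¹sⱼ∈ = Subgroup.∙-closed (T (toℕ i)) (Subgroup.⁻¹-closed (T (toℕ i)) (s∈ i))
      (antitone {toℕ i} {toℕ j} (ℕ.<⇒≤ i<j) (s∈ j))

-- The covering representation

module VectorSpace (F : Field ℓ) (M : LeftModule (Field.ring F) ℓ ℓ) where
  open Field F
  open LeftModule M
  open SemiringMult semiring using () renaming (_×_ to _·_)
  private module RawM = RawMonoidDefinitions +ᴹ-rawMonoid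
  open SetoidReasoning ≈ᴹ-setoid

  -1*-inverse : ∀ x → - 1# *ₗ x +ᴹ x ≈ᴹ 0ᴹ
  -1*-inverse x = begin
    - 1# *ₗ x +ᴹ x           ≈⟨ +ᴹ-congˡ (*ₗ-identityˡ x) ⟨
    - 1# *ₗ x +ᴹ 1# *ₗ x     ≈⟨ *ₗ-distribʳ x (- 1#) 1# ⟨
    (- 1# + 1#) *ₗ x         ≈⟨ *ₗ-congʳ (-‿inverseˡ 1#) ⟩
    0# *ₗ x                  ≈⟨ *ₗ-zeroˡ x ⟩
    0ᴹ                       ∎

  ·-*ₗ : ∀ n x → n RawM.× x ≈ᴹ (n · 1#) *ₗ x
  ·-*ₗ zero    x = ≈ᴹ-sym (*ₗ-zeroˡ x)
  ·-*ₗ (suc n) x = begin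
    x +ᴹ n RawM.× x                ≈⟨ +ᴹ-cong (≈ᴹ-sym (*ₗ-identityˡ x)) (·-*ₗ n x) ⟩
    1# *ₗ x +ᴹ (n · 1#) *ₗ x       ≈⟨ *ₗ-distribʳ x 1# (n · 1#) ⟨
    (1# + n · 1#) *ₗ x             ∎

  fixed-by-nontrivial-scalar : ∀ {a x} → ¬ a ≈ 1# → a *ₗ x ≈ᴹ x → x ≈ᴹ 0ᴹ
  fixed-by-nontrivial-scalar {a} {x} a≉1 ax≈x with invertible {a - 1#} (λ a-1≈0 → a≉1 (x∙y⁻¹≈ε⇒x≈y a 1# a-1≈0))
    where
    open RingProperties ring using (x∙y⁻¹≈ε⇒x≈y)
  ... | b , b*[a-1]≈1 , _ = begin
    x                                    ≈⟨ *ₗ-identityˡ x ⟨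
    1# *ₗ x                              ≈⟨ *ₗ-congʳ b*[a-1]≈1 ⟨
    (b * (a - 1#)) *ₗ x                  ≈⟨ *ₗ-assoc b (a - 1#) x ⟩
    b *ₗ (a - 1#) *ₗ x                   ≈⟨ *ₗ-congˡ (*ₗ-distribʳ x a (- 1#)) ⟩
    b *ₗ (a *ₗ x +ᴹ - 1# *ₗ x)           ≈⟨ *ₗ-congˡ (+ᴹ-congʳ ax≈x) ⟩
    b *ₗ (x +ᴹ - 1# *ₗ x)                ≈⟨ *ₗ-congˡ (+ᴹ-comm x _) ⟩
    b *ₗ (- 1# *ₗ x +ᴹ x)                ≈⟨ *ₗ-congˡ (-1*-inverse x) ⟩
    b *ₗ 0ᴹ                              ≈⟨ *ₗ-zeroʳ b ⟩
    0ᴹ                                   ∎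

-- Formal linear combinations and their pairing with functions.

infixl 6 _⊕_
infixr 7 _⊛_

data Combination {ℓ} (R X : Set ℓ) : Set ℓ where
  gen : X → Combination R X
  0ᶜ  : Combination R X
  _⊕_ : Combination R X → Combination R X → Combination R X
  _⊛_ : R → Combination R X → Combination R X

-- Only an upper bound for the support: generators that cancel or have coefficient zero are still
-- listed. Finiteness is all that is used.
support : ∀ {R X : Set ℓ} → Combination R X → List X
support (gen z) = z ∷ []
support 0ᶜ      = []
support (x ⊕ y) = support x ++ support y
support (a ⊛ x) = support x

mapᶜ : ∀ {R X Y : Set ℓ} → (X → Y) → Combination R X → Combination R Y
mapᶜ f (gen z) = gen (f z)
mapᶜ f 0ᶜ      = 0ᶜ
mapᶜ f (x ⊕ y) = mapᶜ f x ⊕ mapᶜ f y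
mapᶜ f (a ⊛ x) = a ⊛ mapᶜ f x

module Pairing (F : Field ℓ) (M : LeftModule (Field.ring F) ℓ ℓ) (X : Set ℓ) where
  private module F = Field F
  open LeftModule M
  open VectorSpace F M
  open SetoidReasoning ≈ᴹ-setoid
  open FiniteSums +ᴹ-commutativeMonoid

  Comb : Set ℓ
  Comb = Combination F.Carrier X

  -- The linear extension of `φ`, evaluated at the combination.
  ⟨_,_⟩ : Comb → (X → Carrierᴹ) → Carrierᴹ
  ⟨ gen z , φ ⟩ = φ z
  ⟨ 0ᶜ    , φ ⟩ = 0ᴹ
  ⟨ x ⊕ y , φ ⟩ = ⟨ x , φ ⟩ +ᴹ ⟨ y , φ ⟩
  ⟨ a ⊛ x , φ ⟩ = a *ₗ ⟨ x , φ ⟩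

  ⟨⟩-cong-support : ∀ x {φ φ′} → (∀ {z} → Any (z ≡_) (support x) → φ z ≈ᴹ φ′ z) → ⟨ x , φ ⟩ ≈ᴹ ⟨ x , φ′ ⟩
  ⟨⟩-cong-support (gen z) e = e (here ≡.refl)
  ⟨⟩-cong-support 0ᶜ      e = ≈ᴹ-refl
  ⟨⟩-cong-support (x ⊕ y) e = +ᴹ-cong (⟨⟩-cong-support x (e ∘ Any.++⁺ˡ)) (⟨⟩-cong-support y (e ∘ Any.++⁺ʳ (support x)))
  ⟨⟩-cong-support (a ⊛ x) e = *ₗ-congˡ (⟨⟩-cong-support x e)

  ⟨⟩-cong : ∀ x {φ φ′} → (∀ z → φ z ≈ᴹ φ′ z) → ⟨ x , φ ⟩ ≈ᴹ ⟨ x , φ′ ⟩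
  ⟨⟩-cong x e = ⟨⟩-cong-support x (λ {z} _ → e z)

  ⟨⟩-0 : ∀ x {φ} → (∀ z → φ z ≈ᴹ 0ᴹ) → ⟨ x , φ ⟩ ≈ᴹ 0ᴹ
  ⟨⟩-0 (gen z) e = e z
  ⟨⟩-0 0ᶜ      e = ≈ᴹ-refl
  ⟨⟩-0 (x ⊕ y) e = ≈ᴹ-trans (+ᴹ-cong (⟨⟩-0 x e) (⟨⟩-0 y e)) (+ᴹ-identityˡ 0ᴹ)
  ⟨⟩-0 (a ⊛ x) e = ≈ᴹ-trans (*ₗ-congˡ (⟨⟩-0 x e)) (*ₗ-zeroʳ a)

  ⟨⟩-+ : ∀ x {φ φ′} → ⟨ x , (λ z → φ z +ᴹ φ′ z) ⟩ ≈ᴹ ⟨ x , φ ⟩ +ᴹ ⟨ x , φ′ ⟩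
  ⟨⟩-+ (gen z) = ≈ᴹ-refl
  ⟨⟩-+ 0ᶜ      = ≈ᴹ-sym (+ᴹ-identityˡ 0ᴹ)
  ⟨⟩-+ (x ⊕ y) {φ} {φ′} = ≈ᴹ-trans (+ᴹ-cong (⟨⟩-+ x) (⟨⟩-+ y)) (interchange ⟨ x , φ ⟩ ⟨ x , φ′ ⟩ ⟨ y , φ ⟩ ⟨ y , φ′ ⟩)
    where
    open CommutativeMonoid +ᴹ-commutativeMonoid using (commutativeSemigroup)
    open CommutativeSemigroupProperties commutativeSemigroup using (interchange)
  ⟨⟩-+ (a ⊛ x) = ≈ᴹ-trans (*ₗ-congˡ (⟨⟩-+ x)) (*ₗ-distribˡ a _ _)

  ⟨⟩-∑ : ∀ x {n} (φ : Fin n → X → Carrierᴹ) → ⟨ x , (λ z → sum (λ i → φ i z)) ⟩ ≈ᴹ sum (λ i → ⟨ x , φ i ⟩)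
  ⟨⟩-∑ x {zero}  φ = ⟨⟩-0 x (λ _ → ≈ᴹ-refl)
  ⟨⟩-∑ x {suc n} φ = ≈ᴹ-trans (⟨⟩-+ x) (+ᴹ-congˡ (⟨⟩-∑ x (φ ∘ suc)))

  ⟨⟩-mapᶜ : ∀ f x {φ} → ⟨ mapᶜ f x , φ ⟩ ≈ᴹ ⟨ x , φ ∘ f ⟩
  ⟨⟩-mapᶜ f (gen z) = ≈ᴹ-refl
  ⟨⟩-mapᶜ f 0ᶜ      = ≈ᴹ-refl
  ⟨⟩-mapᶜ f (x ⊕ y) = +ᴹ-cong (⟨⟩-mapᶜ f x) (⟨⟩-mapᶜ f y)
  ⟨⟩-mapᶜ f (a ⊛ x) = *ₗ-congˡ (⟨⟩-mapᶜ f x)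

  record IsLinear (T : Carrierᴹ → Carrierᴹ) : Set ℓ where
    field
      cong   : ∀ {x y} → x ≈ᴹ y → T x ≈ᴹ T y
      +-homo : ∀ x y → T (x +ᴹ y) ≈ᴹ T x +ᴹ T y
      *-homo : ∀ a x → T (a *ₗ x) ≈ᴹ a *ₗ T x

    0-homo : T 0ᴹ ≈ᴹ 0ᴹ
    0-homo = begin
      T 0ᴹ               ≈⟨ cong (*ₗ-zeroˡ 0ᴹ) ⟨
      T (F.0# *ₗ 0ᴹ)     ≈⟨ *-homo F.0# 0ᴹ ⟩
      F.0# *ₗ T 0ᴹ       ≈⟨ *ₗ-zeroˡ (T 0ᴹ) ⟩
      0ᴹ                 ∎

    ⟨⟩-homo : ∀ x {φ} → ⟨ x , T ∘ φ ⟩ ≈ᴹ T ⟨ x , φ ⟩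
    ⟨⟩-homo (gen z) = ≈ᴹ-refl
    ⟨⟩-homo 0ᶜ      = ≈ᴹ-sym 0-homo
    ⟨⟩-homo (x ⊕ y) = ≈ᴹ-trans (+ᴹ-cong (⟨⟩-homo x) (⟨⟩-homo y)) (≈ᴹ-sym (+-homo _ _))
    ⟨⟩-homo (a ⊛ x) = ≈ᴹ-trans (*ₗ-congˡ (⟨⟩-homo x)) (≈ᴹ-sym (*-homo a _))

    ∑-homo : ∀ {n} (t : Fin n → Carrierᴹ) → T (sum t) ≈ᴹ sum (T ∘ t)
    ∑-homo {zero}  t = 0-homo
    ∑-homo {suc n} t = ≈ᴹ-trans (+-homo _ _) (+ᴹ-congˡ (∑-homo (t ∘ suc)))

    when-homo : ∀ {P : Set ℓ} (d : Dec P) {x} → T (when d x) ≈ᴹ when d (T x)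
    when-homo (yes _) = ≈ᴹ-refl
    when-homo (no _)  = 0-homo

  scaling-linear : ∀ a → IsLinear (a *ₗ_)
  scaling-linear a = record
    { cong   = *ₗ-congˡ
    ; +-homo = *ₗ-distribˡ a
    ; *-homo = λ b x → begin
        a *ₗ b *ₗ x          ≈⟨ *ₗ-assoc a b x ⟨
        (a F.* b) *ₗ x       ≈⟨ *ₗ-congʳ (F.*-comm a b) ⟩
        (b F.* a) *ₗ x       ≈⟨ *ₗ-assoc b a x ⟩
        b *ₗ a *ₗ x          ∎
    }

  module _ (em : ExcludedMiddle ℓ) where
    restrict : (X → Set ℓ) → (X → Carrierᴹ) → X → Carrierᴹ
    restrict E φ z = when (em {E z}) (φ z)

    -- Only finitely many classes meet the support, and they are peeled off one listed point at a
    -- time. A point whose class recurs later in the list adds nothing; otherwise its class is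
    -- disjoint from the rest and the function splits as a sum.
    ⟨⟩-partition : ∀ {_∼_ : X → X → Set ℓ} → IsEquivalence _∼_ → ∀ x φ →
                   (∀ w → ⟨ x , restrict (_∼ w) φ ⟩ ≈ᴹ 0ᴹ) → ⟨ x , φ ⟩ ≈ᴹ 0ᴹ
    ⟨⟩-partition {_∼_} ∼-equiv x φ vanish = begin
      ⟨ x , φ ⟩
        ≈⟨ ⟨⟩-cong-support x (λ z∈ → ≈ᴹ-sym (when-yes em (Any.map (λ { ≡.refl → ∼.refl }) z∈))) ⟩
      ⟨ x , restrict (Near (support x)) φ ⟩    ≈⟨ near (support x) ⟩
      0ᴹ                                       ∎
      where
      module ∼ = IsEquivalence ∼-equiv
      Near : List X → X → Set ℓ
      Near ws z = Any (z ∼_) ws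
      near : ∀ ws → ⟨ x , restrict (Near ws) φ ⟩ ≈ᴹ 0ᴹ
      near [] = ⟨⟩-0 x (λ z → when-no em λ ())
      near (w ∷ ws) with em {Near ws w}
      ... | yes w∈ = begin
        ⟨ x , restrict (Near (w ∷ ws)) φ ⟩
          ≈⟨ ⟨⟩-cong x (λ z → when-cong em em
               (λ { (here z∼w) → Any.map (∼.trans z∼w) w∈ ; (there p) → p }) there (λ _ → ≈ᴹ-refl)) ⟩
        ⟨ x , restrict (Near ws) φ ⟩
          ≈⟨ near ws ⟩
        0ᴹ ∎
      ... | no w∉ = begin
        ⟨ x , restrict (Near (w ∷ ws)) φ ⟩
          ≈⟨ ⟨⟩-cong x split ⟩
        ⟨ x , (λ z → restrict (_∼ w) φ z +ᴹ restrict (Near ws) φ z) ⟩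
          ≈⟨ ⟨⟩-+ x ⟩
        ⟨ x , restrict (_∼ w) φ ⟩ +ᴹ ⟨ x , restrict (Near ws) φ ⟩
          ≈⟨ +ᴹ-cong (vanish w) (near ws) ⟩
        0ᴹ +ᴹ 0ᴹ
          ≈⟨ +ᴹ-identityˡ 0ᴹ ⟩
        0ᴹ ∎
        where
        split : ∀ z → restrict (Near (w ∷ ws)) φ z ≈ᴹ restrict (_∼ w) φ z +ᴹ restrict (Near ws) φ z
        split z with em {z ∼ w} | em {Near ws z}
        ... | yes z∼w | yes z∈ = contradiction (Any.map (∼.trans (∼.sym z∼w)) z∈) w∉
        ... | yes z∼w | no  z∉ = ≈ᴹ-trans (when-yes em (here z∼w)) (≈ᴹ-sym (+ᴹ-identityʳ _))
        ... | no  z≁w | yes z∈ = ≈ᴹ-trans (when-yes em (there z∈)) (≈ᴹ-sym (+ᴹ-identityˡ _))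
        ... | no  z≁w | no  z∉ = ≈ᴹ-trans
          (when-no em (λ { (here p) → z≁w p ; (there p) → z∉ p })) (≈ᴹ-sym (+ᴹ-identityˡ 0ᴹ))

  module _ (Test : (X → Carrierᴹ) → Set ℓ) where
    infix 4 _≈ᶜ_
    -- With equality tested by functions, each module law is an instance of the same law in `M`, and
    -- no congruence has to be generated.
    _≈ᶜ_ : Comb → Comb → Set ℓ
    x ≈ᶜ y = ∀ φ → Test φ → ⟨ x , φ ⟩ ≈ᴹ ⟨ y , φ ⟩

    combinations : LeftModule F.ring ℓ ℓ
    combinations = record
      { Carrierᴹ = Comb
      ; _≈ᴹ_ = _≈ᶜ_
      ; _+ᴹ_ = _⊕_
      ; _*ₗ_ = _⊛_
      ; 0ᴹ = 0ᶜ
      ; -ᴹ_ = λ x → (F.- F.1#) ⊛ x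
      ; isLeftModule = record
        { isLeftSemimodule = record
          { +ᴹ-isCommutativeMonoid = record
            { isMonoid = record
              { isSemigroup = record
                { isMagma = record
                  { isEquivalence = record
                    { refl = λ _ _ → ≈ᴹ-refl
                    ; sym = λ e φ t → ≈ᴹ-sym (e φ t)
                    ; trans = λ e e′ φ t → ≈ᴹ-trans (e φ t) (e′ φ t)
                    }
                  ; ∙-cong = λ e e′ φ t → +ᴹ-cong (e φ t) (e′ φ t)
                  }
                ; assoc = λ _ _ _ _ _ → +ᴹ-assoc _ _ _
                }
              ; identity = (λ _ _ _ → +ᴹ-identityˡ _) , (λ _ _ _ → +ᴹ-identityʳ _)
              }
            ; comm = λ _ _ _ _ → +ᴹ-comm _ _
            }
          ; isPreleftSemimodule = record
            { *ₗ-cong = λ a≈b e φ t → *ₗ-cong a≈b (e φ t)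
            ; *ₗ-zeroˡ = λ _ _ _ → *ₗ-zeroˡ _
            ; *ₗ-distribʳ = λ _ _ _ _ _ → *ₗ-distribʳ _ _ _
            ; *ₗ-identityˡ = λ _ _ _ → *ₗ-identityˡ _
            ; *ₗ-assoc = λ _ _ _ _ _ → *ₗ-assoc _ _ _
            ; *ₗ-zeroʳ = λ _ _ _ → *ₗ-zeroʳ _
            ; *ₗ-distribˡ = λ _ _ _ _ _ → *ₗ-distribˡ _ _ _
            }
          }
        ; -ᴹ‿cong = λ e φ t → *ₗ-congˡ (e φ t)
        ; -ᴹ‿inverse = (λ _ _ _ → -1*-inverse _) , (λ _ _ _ → ≈ᴹ-trans (+ᴹ-comm _ _) (-1*-inverse _))
        }
      }

-- Stated for a bare action because it is applied to `P` and also to the cover, where it helps to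
-- prove smoothness before a `SmoothRep` exists.
module Stabilizers
  (G : Group ℓ ℓ) (Y : Setoid ℓ ℓ) (_▷_ : Group.Carrier G → Setoid.Carrier Y → Setoid.Carrier Y)
  (▷-cong : ∀ {g h v w} → Group._≈_ G g h → Setoid._≈_ Y v w → Setoid._≈_ Y (g ▷ v) (h ▷ w))
  (▷-identity : ∀ v → Setoid._≈_ Y (Group.ε G ▷ v) v)
  (▷-assoc : ∀ g h v → Setoid._≈_ Y (Group._∙_ G g h ▷ v) (g ▷ (h ▷ v)))
  where
  private
    module G = Group G
    module Y = Setoid Y

  stabilizer : Y.Carrier → Subgroup G
  stabilizer v = record
    { ⌞_⌟       = λ g → (g ▷ v) Y.≈ v
    ; resp-≈    = λ g≈h e → Y.trans (▷-cong (G.sym g≈h) Y.refl) e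
    ; ε-closed  = ▷-identity v
    ; ∙-closed  = λ e e′ → Y.trans (▷-assoc _ _ v) (Y.trans (▷-cong G.refl e′) e)
    ; ⁻¹-closed = λ {g} e → Y.trans (▷-cong G.refl (Y.sym e))
        (Y.trans (Y.sym (▷-assoc _ _ v)) (Y.trans (▷-cong (G.inverseˡ g) Y.refl) (▷-identity v)))
    }

module CoveringRep (F : Field ℓ) (G : TopologicalGroup ℓ) (C : Subgroup (TopologicalGroup.group G))
                   (χ : ContinuousCharacter F (subgroupᵗ G C)) (central : IsCentral C)
                   (P : Mod.SmoothRep F G C χ) where
  open Mod F G C χ
  private
    module F = Field F
    module G = TopologicalGroup G
    module χ = ContinuousHom χ
  open SmoothRep P
  open OpenSubgroups G
  open VectorSpace F vectorSpace
  open Pairing F vectorSpace (G.Carrier × Carrierᴹ)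
  open SetoidReasoning ≈ᴹ-setoid

  ▷-linear : ∀ g → IsLinear (g ▷_)
  ▷-linear g = record { cong = ▷-cong G.refl ; +-homo = ▷-+ᴹ g ; *-homo = ▷-*ₗ g }

  ψ : G.Carrier × Carrierᴹ → Carrierᴹ
  ψ (g , v) = g ▷ v

  open Stabilizers G.group ≈ᴹ-setoid _▷_ ▷-cong ▷-identity ▷-assoc public

  module _ (H : Carrierᴹ → Subgroup G.group) (oH : ∀ v → G.IsOpen ⌞ H v ⌟)
           (H-fixes : ∀ v → ⌞ H v ⌟ ⊆ ⌞ stabilizer v ⌟) where

    -- Free combinations of pairs (g , v) modulo the common kernel of these
    -- functions stand in for ⨁ᵥ c-Ind χ.  Since the functions take values in
    -- P, the map ψ is one of them and the covering is well defined at once.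
    record IsTest (φ : G.Carrier × Carrierᴹ → Carrierᴹ) : Set ℓ where
      field
        cong    : ∀ {x y} v → x G.≈ y → φ (x , v) ≈ᴹ φ (y , v)
        H-right : ∀ {x h} v → ⌞ H v ⌟ h → φ (x G.∙ h , v) ≈ᴹ φ (x , v)
        C-right : ∀ {x} v (c : Σ G.Carrier ⌞ C ⌟) → φ (x G.∙ proj₁ c , v) ≈ᴹ proj₁ χ.⟦ c ⟧ *ₗ φ (x , v)

    shift : G.Carrier → G.Carrier × Carrierᴹ → G.Carrier × Carrierᴹ
    shift g (x , v) = g G.∙ x , v

    -- Left translation commutes with the right translations in `IsTest`; this is why the action
    -- descends to the quotient.
    shift-test : ∀ {φ} g → IsTest φ → IsTest (φ ∘ shift g)
    shift-test g t = record
      { cong    = λ v e → T.cong v (G.∙-congˡ e)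
      ; H-right = λ v h∈H → ≈ᴹ-trans (T.cong v (G.sym (G.assoc _ _ _))) (T.H-right v h∈H)
      ; C-right = λ v c → ≈ᴹ-trans (T.cong v (G.sym (G.assoc _ _ _))) (T.C-right v c)
      }
      where
      module T = IsTest t

    ψ-test : IsTest ψ
    ψ-test = record
      { cong    = λ v e → ▷-cong e ≈ᴹ-refl
      ; H-right = λ v h∈H → ≈ᴹ-trans (▷-assoc _ _ v) (▷-cong G.refl (H-fixes v h∈H))
      ; C-right = λ {x} v c → ≈ᴹ-trans (▷-assoc _ _ v) (≈ᴹ-trans (▷-cong G.refl (character c v)) (▷-*ₗ x _ v))
      }

    private module Q = LeftModule (combinations IsTest)

    infixr 8 _▷ᶜ_
    _▷ᶜ_ : G.Carrier → Comb → Comb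
    g ▷ᶜ x = mapᶜ (shift g) x

    ▷ᶜ-cong : ∀ {g h x y} → g G.≈ h → x Q.≈ᴹ y → g ▷ᶜ x Q.≈ᴹ h ▷ᶜ y
    ▷ᶜ-cong {g} {h} {x} {y} g≈h x≈y φ t = begin
      ⟨ g ▷ᶜ x , φ ⟩          ≈⟨ ⟨⟩-mapᶜ (shift g) x ⟩
      ⟨ x , φ ∘ shift g ⟩     ≈⟨ x≈y _ (shift-test g t) ⟩
      ⟨ y , φ ∘ shift g ⟩     ≈⟨ ⟨⟩-cong y (λ { (_ , v) → IsTest.cong t v (G.∙-congʳ g≈h) }) ⟩
      ⟨ y , φ ∘ shift h ⟩     ≈⟨ ⟨⟩-mapᶜ (shift h) y ⟨
      ⟨ h ▷ᶜ y , φ ⟩          ∎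

    ▷ᶜ-identity : ∀ x → G.ε ▷ᶜ x Q.≈ᴹ x
    ▷ᶜ-identity x φ t = ≈ᴹ-trans (⟨⟩-mapᶜ _ x) (⟨⟩-cong x λ { (_ , v) → IsTest.cong t v (G.identityˡ _) })

    ▷ᶜ-assoc : ∀ g h x → (g G.∙ h) ▷ᶜ x Q.≈ᴹ g ▷ᶜ h ▷ᶜ x
    ▷ᶜ-assoc g h x φ t = begin
      ⟨ (g G.∙ h) ▷ᶜ x , φ ⟩           ≈⟨ ⟨⟩-mapᶜ _ x ⟩
      ⟨ x , φ ∘ shift (g G.∙ h) ⟩      ≈⟨ ⟨⟩-cong x (λ { (_ , v) → IsTest.cong t v (G.assoc g h _) }) ⟩
      ⟨ x , φ ∘ shift g ∘ shift h ⟩    ≈⟨ ⟨⟩-mapᶜ (shift h) x ⟨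
      ⟨ h ▷ᶜ x , φ ∘ shift g ⟩         ≈⟨ ⟨⟩-mapᶜ (shift g) (h ▷ᶜ x) ⟨
      ⟨ g ▷ᶜ h ▷ᶜ x , φ ⟩              ∎

    -- An explicit open neighbourhood of `ε` inside the stabilizer, possibly smaller than it, which
    -- suffices for smoothness.
    fixer : Comb → G.Carrier → Set ℓ
    fixer (gen (g , v)) = ⌞ H v ^ᶜ g ⌟
    fixer 0ᶜ            = λ _ → ⊤
    fixer (x ⊕ y)       = fixer x ∩ fixer y
    fixer (a ⊛ x)       = fixer x

    fixer-open : ∀ x → G.IsOpen (fixer x)
    fixer-open (gen (g , v)) = open-conjugate (oH v) g
    fixer-open 0ᶜ            = G.open-⊤
    fixer-open (x ⊕ y)       = G.open-∩ (fixer-open x) (fixer-open y)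
    fixer-open (a ⊛ x)       = fixer-open x

    ε∈fixer : ∀ x → fixer x G.ε
    ε∈fixer (gen (g , v)) = Subgroup.ε-closed (H v ^ᶜ g)
    ε∈fixer 0ᶜ            = tt
    ε∈fixer (x ⊕ y)       = ε∈fixer x , ε∈fixer y
    ε∈fixer (a ⊛ x)       = ε∈fixer x

    fixer-fixes : ∀ x {g} → fixer x g → g ▷ᶜ x Q.≈ᴹ x
    fixer-fixes (gen (y , v)) {g} g∈ φ t = ≈ᴹ-trans
      (IsTest.cong t v (solve 2 (λ g y → g S.⊕ y ⊜ y S.⊕ (S.⊖ y S.⊕ g S.⊕ y)) G.refl g y)) (IsTest.H-right t v g∈)
      where
      module S = GroupSolver G.group
      open S using (solve; _⊜_)
    fixer-fixes 0ᶜ      _         φ t = ≈ᴹ-refl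
    fixer-fixes (x ⊕ y) (g∈ , g∈′) φ t = +ᴹ-cong (fixer-fixes x g∈ φ t) (fixer-fixes y g∈′ φ t)
    fixer-fixes (a ⊛ x) g∈        φ t = *ₗ-congˡ (fixer-fixes x g∈ φ t)

    -- Centrality moves `c` from the left to the right, where test functions turn it into `χ`.
    ▷ᶜ-character : ∀ c x → proj₁ c ▷ᶜ x Q.≈ᴹ proj₁ χ.⟦ c ⟧ ⊛ x
    ▷ᶜ-character c x φ t = begin
      ⟨ proj₁ c ▷ᶜ x , φ ⟩                       ≈⟨ ⟨⟩-mapᶜ _ x ⟩
      ⟨ x , φ ∘ shift (proj₁ c) ⟩                ≈⟨ ⟨⟩-cong x (λ { (g , v) →
                                                      ≈ᴹ-trans (IsTest.cong t v (central (proj₂ c) g)) (IsTest.C-right t v c) }) ⟩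
      ⟨ x , (proj₁ χ.⟦ c ⟧ *ₗ_) ∘ φ ⟩            ≈⟨ IsLinear.⟨⟩-homo (scaling-linear _) x ⟩
      proj₁ χ.⟦ c ⟧ *ₗ ⟨ x , φ ⟩                 ∎

    private
      module S = Stabilizers G.group Q.≈ᴹ-setoid _▷ᶜ_ (λ {g} {h} {x} {y} → ▷ᶜ-cong {g} {h} {x} {y}) ▷ᶜ-identity ▷ᶜ-assoc

    rep : SmoothRep
    rep = record
      { vectorSpace = combinations IsTest
      ; _▷_        = _▷ᶜ_
      ; ▷-cong     = λ {g} {h} {x} {y} → ▷ᶜ-cong {g} {h} {x} {y}
      ; ▷-identity = ▷ᶜ-identity
      ; ▷-assoc    = ▷ᶜ-assoc
      ; ▷-+ᴹ       = λ _ _ _ _ _ → ≈ᴹ-refl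
      ; ▷-*ₗ       = λ _ _ _ _ _ → ≈ᴹ-refl
      ; smooth     = λ x → open-subgroup (S.stabilizer x)
                       (fixer-open x) (ε∈fixer x) (fixer-fixes x)
      ; character  = ▷ᶜ-character
      }

    covering : Hom rep P
    covering = record
      { ⟦_⟧ = ⟨_, ψ ⟩
      ; linear = record
        { +ᴹ-isGroupHomomorphism = record
          { isMonoidHomomorphism = record
            { isMagmaHomomorphism = record
              { isRelHomomorphism = record { cong = λ e → e ψ ψ-test }
              ; homo = λ _ _ → ≈ᴹ-refl
              }
            ; ε-homo = ≈ᴹ-refl
            }
          ; ⁻¹-homo = λ _ → inverseˡ-uniqueᴹ _ _ (-1*-inverse _)
          }
        ; *ₗ-homo = λ _ _ → ≈ᴹ-refl
        }
      ; equivariant = λ g x → ≈ᴹ-trans (⟨⟩-mapᶜ _ x)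
          (≈ᴹ-trans (⟨⟩-cong x λ { (h , v) → ▷-assoc g h v }) (IsLinear.⟨⟩-homo (▷-linear g) x))
      }
      where open LeftModuleProperties vectorSpace using (inverseˡ-uniqueᴹ)

    -- The covering is surjective, with `gen (ε , v)` lying over `v`.
    covering-epi : IsEpi covering
    covering-epi {Z} f f′ eq v = Z.≈ᴹ-trans (f.⟦⟧-cong (≈ᴹ-sym (▷-identity v)))
      (Z.≈ᴹ-trans (eq (gen (G.ε , v))) (f′.⟦⟧-cong (▷-identity v)))
      where
      module Z = SmoothRep Z
      module f = LeftModuleMorphisms.IsLeftModuleHomomorphism (Hom.linear f)
      module f′ = LeftModuleMorphisms.IsLeftModuleHomomorphism (Hom.linear f′)

-- Invariant vectors

module InvariantVectors
  (em : ExcludedMiddle ℓ) (F : Field ℓ) {p : ℕ} (char : HasCharacteristic F p)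
  (G : TopologicalGroup ℓ) (C : Subgroup (TopologicalGroup.group G)) (central : IsCentral C)
  (χ : ContinuousCharacter F (subgroupᵗ G C)) (P : Mod.SmoothRep F G C χ)
  where

  open Mod F G C χ
  private
    module F = Field F
    module G = TopologicalGroup G
    module χ = ContinuousHom χ
  open G using (_∙_; _⁻¹; ε)
  open SmoothRep P
  open OpenSubgroups G
  open CentralProduct G C central
  open Cosets em G.group
  open CoveringRep F G C χ central P
  open VectorSpace F vectorSpace
  open Pairing F vectorSpace (G.Carrier × Carrierᴹ)
  open FiniteSums +ᴹ-commutativeMonoid
  open GroupSolver G.group using (solve; _⊜_; ∅; ⊖_) renaming (_⊕_ to _⊞_)

  ·C-eigenvector : ∀ {H : Subgroup G.group} {v} → ⌞ H ⌟ ⊆ ⌞ stabilizer v ⌟ →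
                   ∀ {j} → ⌞ H ·C ⌟ j → ∃[ a ] j ▷ v ≈ᴹ a *ₗ v
  ·C-eigenvector {v = v} H-fixes {j} (h , c , h∈H , c∈C , j≈) = proj₁ χ.⟦ c , c∈C ⟧ , (begin
    j ▷ v                          ≈⟨ ▷-cong j≈ ≈ᴹ-refl ⟩
    (h ∙ c) ▷ v                    ≈⟨ ▷-assoc h c v ⟩
    h ▷ c ▷ v                      ≈⟨ ▷-cong G.refl (character (c , c∈C) v) ⟩
    h ▷ (proj₁ χ.⟦ c , c∈C ⟧ *ₗ v) ≈⟨ ▷-*ₗ h _ v ⟩
    proj₁ χ.⟦ c , c∈C ⟧ *ₗ h ▷ v   ≈⟨ *ₗ-congˡ (H-fixes h∈H) ⟩
    proj₁ χ.⟦ c , c∈C ⟧ *ₗ v       ∎)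
    where open SetoidReasoning ≈ᴹ-setoid

  open SetoidReasoning ≈ᴹ-setoid

  -- If S moves Z, then the sum is an eigenvector of a group element with
  -- eigenvalue ≠ 1 that is also fixed by it; otherwise it is [S : S′] Z.
  ∑-orbit≈0 : ∀ {S S′ : Subgroup G.group} → ⌞ S′ ⌟ ⊆ ⌞ S ⌟ → ∀ {m} {q : Fin m → G.Carrier} → IsTransversal S S′ q →
              p ∣ m → ∀ {Z} → (∀ {s} → ⌞ S ⌟ s → ∃[ a ] s ▷ Z ≈ᴹ a *ₗ Z) → ⌞ S′ ⌟ ⊆ ⌞ stabilizer Z ⌟ →
              sum (λ i → q i ▷ Z) ≈ᴹ 0ᴹ
  ∑-orbit≈0 {S} {S′} S′⊆S {m} {q} Q p∣m {Z} eigen S′-fixes with em {∃[ s ] (⌞ S ⌟ s × ¬ s ▷ Z ≈ᴹ Z)}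
  ... | no fixed = begin
    sum (λ i → q i ▷ Z)           ≈⟨ sum-cong-≋ (λ i → fix (member i)) ⟩
    sum {m} (λ _ → Z)             ≈⟨ sum-replicate m ⟩
    _                             ≈⟨ ·-*ₗ m Z ⟩
    _ *ₗ Z                        ≈⟨ *ₗ-congʳ (Equivalence.from (char m) p∣m) ⟩
    F.0# *ₗ Z                     ≈⟨ *ₗ-zeroˡ Z ⟩
    0ᴹ                            ∎
    where
    open IsTransversal Q
    fix : ∀ {s} → ⌞ S ⌟ s → s ▷ Z ≈ᴹ Z
    fix {s} s∈S with em {s ▷ Z ≈ᴹ Z}
    ... | yes e = e
    ... | no ¬e = contradiction (s , s∈S , ¬e) fixed
  ... | yes (s , s∈S , moved) with eigen s∈S
  ... | a , sZ≈aZ = fixed-by-nontrivial-scalar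
    (λ a≈1 → moved (≈ᴹ-trans sZ≈aZ (≈ᴹ-trans (*ₗ-congʳ a≈1) (*ₗ-identityˡ Z)))) (begin
      a *ₗ sum (λ i → q i ▷ Z)              ≈⟨ IsLinear.∑-homo (scaling-linear a) {m} (λ i → q i ▷ Z) ⟩
      sum (λ i → a *ₗ q i ▷ Z)              ≈⟨ sum-cong-≋ (λ i → scale (eigen (IsTransversal.member Q i))) ⟨
      sum (λ i → s ▷ q i ▷ Z)               ≈⟨ sum-cong-≋ (λ i → ▷-assoc s (q i) Z) ⟨
      sum (λ i → (s ∙ q i) ▷ Z)             ≈⟨ ∑-translate +ᴹ-commutativeMonoid {S} {S′} S′⊆S Q (_▷ Z) (λ _ → respects) s∈S ⟨
      sum (λ i → q i ▷ Z)                   ∎)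
    where
    -- Each `q i ▷ Z` is a multiple of `Z`, so `s` scales all of them by the same `a`.
    scale : ∀ {g} → ∃[ b ] g ▷ Z ≈ᴹ b *ₗ Z → s ▷ g ▷ Z ≈ᴹ a *ₗ g ▷ Z
    scale {g} (b , gZ≈bZ) = begin
      s ▷ g ▷ Z          ≈⟨ ▷-cong G.refl gZ≈bZ ⟩
      s ▷ (b *ₗ Z)       ≈⟨ ▷-*ₗ s b Z ⟩
      b *ₗ s ▷ Z         ≈⟨ *ₗ-congˡ sZ≈aZ ⟩
      b *ₗ a *ₗ Z        ≈⟨ IsLinear.*-homo (scaling-linear a) b Z ⟨
      a *ₗ b *ₗ Z        ≈⟨ *ₗ-congˡ gZ≈bZ ⟨
      a *ₗ g ▷ Z         ∎
    respects : ∀ {x y} → x ∼[ S′ ] y → x ▷ Z ≈ᴹ y ▷ Z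
    respects {x} {y} x∼y = begin
      x ▷ Z                      ≈⟨ ▷-cong G.refl (S′-fixes x∼y) ⟨
      x ▷ (x ⁻¹ ∙ y) ▷ Z         ≈⟨ ▷-assoc x _ Z ⟨
      (x ∙ (x ⁻¹ ∙ y)) ▷ Z       ≈⟨ ▷-cong (solve 2 (λ x y → x ⊞ (⊖ x ⊞ y) ⊜ y) G.refl x y) ≈ᴹ-refl ⟩
      y ▷ Z                      ∎

  module _ (L : Subgroup G.group) (H₀ H : Carrierᴹ → Subgroup G.group)
           (H₀-fixes : ∀ v → ⌞ H₀ v ⌟ ⊆ ⌞ stabilizer v ⌟) (H⊆H₀ : ∀ v → ⌞ H v ⌟ ⊆ ⌞ H₀ v ⌟)
           (oH : ∀ v → G.IsOpen ⌞ H v ⌟)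
    where

    private
      module L = Subgroup L
      module J (v : Carrierᴹ) = Subgroup (H v ·C)
      module J∼ (v : Carrierᴹ) = Setoid (cosets G.group (H v ·C))

    H-fixes : ∀ v → ⌞ H v ⌟ ⊆ ⌞ stabilizer v ⌟
    H-fixes v h∈H = H₀-fixes v (H⊆H₀ v h∈H)

    Index : Set ℓ
    Index = G.Carrier × Carrierᴹ

    -- The substitute for projecting the cover onto a summand: cutting off along a union of left
    -- cosets respects right translation by both `H v` and `C`.
    restrict-test : ∀ {E : Index → Set ℓ} {φ} → (∀ {x y v} → x ∼[ H v ·C ] y → E (x , v) → E (y , v)) →
                    IsTest H oH H-fixes φ → IsTest H oH H-fixes (restrict em E φ)
    restrict-test {E} {φ} stable t = record
      { cong    = λ {x} {y} v x≈y → when-cong em em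
                    (stable (J.resp-≈ v (x∼y x≈y) (J.ε-closed v))) (stable (J.resp-≈ v (x∼y (G.sym x≈y)) (J.ε-closed v)))
                    (λ _ → T.cong v x≈y)
      ; H-right = λ {x} {h} v h∈H → when-cong em em
                    (stable (J∼.sym v {x} (x∼xj v (⊆·C (H v) h∈H)))) (stable (x∼xj v (⊆·C (H v) h∈H)))
                    (λ _ → T.H-right v h∈H)
      ; C-right = λ {x} v c → ≈ᴹ-trans
                    (when-cong em em
                      (stable (J∼.sym v {x} (x∼xj v (C⊆·C (H v) (proj₂ c)))))
                      (stable (x∼xj v (C⊆·C (H v) (proj₂ c))))
                      (λ _ → T.C-right v c))
                    (≈ᴹ-sym (IsLinear.when-homo (scaling-linear _) em))
      }
      where
      module T = IsTest t
      x∼y : ∀ {x y} → x G.≈ y → ε G.≈ x ⁻¹ ∙ y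
      x∼y {x} x≈y = G.trans (G.sym (G.inverseˡ x)) (G.∙-congˡ x≈y)
      x∼xj : ∀ {x j} v → ⌞ H v ·C ⌟ j → x ∼[ H v ·C ] (x ∙ j)
      x∼xj {x} {j} v j∈ = J.resp-≈ v (solve 2 (λ x j → j ⊜ ⊖ x ⊞ (x ⊞ j)) G.refl x j) j∈

    infix 4 _≃_
    -- The classes are the double cosets of `L` and `H v · C`. The vectors are compared by `_≡_`
    -- because `H` is not assumed to respect `_≈ᴹ_`.
    _≃_ : Index → Index → Set ℓ
    (x , u) ≃ (g , v) = u ≡ v × ∃[ l ] (⌞ L ⌟ l × (l ∙ g) ∼[ H v ·C ] x)

    ≃-isEquivalence : IsEquivalence _≃_
    ≃-isEquivalence = record
      { refl  = λ { {x , v} → ≡.refl , ε , L.ε-closed ,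
          J.resp-≈ v (solve 1 (λ x → ∅ ⊜ ⊖ (∅ ⊞ x) ⊞ x) G.refl x) (J.ε-closed v) }
      ; sym   = λ { {x , v} {g , _} (≡.refl , l , l∈L , e) → ≡.refl , l ⁻¹ , L.⁻¹-closed l∈L ,
          J.resp-≈ v (solve 3 (λ x g l → ⊖ (⊖ (l ⊞ g) ⊞ x) ⊜ ⊖ (⊖ l ⊞ x) ⊞ g) G.refl x g l) (J.⁻¹-closed v e) }
      ; trans = λ { {x , v} {y , _} {z , _} (≡.refl , l , l∈L , e) (≡.refl , m , m∈L , e′) →
          ≡.refl , l ∙ m , L.∙-closed l∈L m∈L , J.resp-≈ v
            (solve 5 (λ x y z l m → ⊖ (m ⊞ z) ⊞ y ⊞ (⊖ (l ⊞ y) ⊞ x) ⊜ ⊖ (l ⊞ m ⊞ z) ⊞ x) G.refl x y z l m)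
            (J.∙-closed v e′ e) }
      }

    module _ (x : Comb)
             (invariant : ∀ {l} → ⌞ L ⌟ l → ∀ φ → IsTest H oH H-fixes φ → ⟨ _▷ᶜ_ H oH H-fixes l x , φ ⟩ ≈ᴹ ⟨ x , φ ⟩)
             (g : G.Carrier) (v : Carrierᴹ) where

      S S′ : Subgroup G.group
      S  = L ⊓ (H₀ v ·C) ^ᶜ g
      S′ = L ⊓ (H v ·C) ^ᶜ g

      S′⊆S : ⌞ S′ ⌟ ⊆ ⌞ S ⌟
      S′⊆S (l∈L , j) = l∈L , ·C-mono {H v} {H₀ v} (H⊆H₀ v) j

      -- The single left coset `k g (H v · C)` in the summand of `v`. As `k` runs over `L` modulo
      -- `S′`, these cosets partition the class of `(g , v)`.
      D : G.Carrier → Index → Set ℓ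
      D k (y , u) = u ≡ v × (k ∙ g) ∼[ H v ·C ] y

      ψ′ : G.Carrier → Index → Carrierᴹ
      ψ′ k = restrict em (D k) ψ

      ψ′-test : ∀ k → IsTest H oH H-fixes (ψ′ k)
      ψ′-test k = restrict-test
        (λ { {y} {y′} y∼y′ (≡.refl , e) → ≡.refl , J∼.trans v {k ∙ g} {y} {y′} e y∼y′ }) (ψ-test H oH H-fixes)

      S′-coset : ∀ {k k′} → ⌞ H v ·C ⌟ ((k ∙ g) ⁻¹ ∙ (k′ ∙ g)) → ⌞ (H v ·C) ^ᶜ g ⌟ (k ⁻¹ ∙ k′)
      S′-coset {k} {k′} = J.resp-≈ v (solve 3 (λ g k k′ → ⊖ (k ⊞ g) ⊞ (k′ ⊞ g) ⊜ ⊖ g ⊞ (⊖ k ⊞ k′) ⊞ g) G.refl g k k′)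

      coset-S′ : ∀ {k k′} → k ∼[ S′ ] k′ → (k ∙ g) ∼[ H v ·C ] (k′ ∙ g)
      coset-S′ {k} {k′} (_ , e) = J.resp-≈ v
        (solve 3 (λ g k k′ → ⊖ g ⊞ (⊖ k ⊞ k′) ⊞ g ⊜ ⊖ (k ⊞ g) ⊞ (k′ ⊞ g)) G.refl g k k′) e

      ψ′-resp : ∀ {k k′} → k ∼[ S′ ] k′ → ∀ z → ψ′ k z ≈ᴹ ψ′ k′ z
      ψ′-resp {k} {k′} k∼k′ (y , u) = when-cong em em
        (λ { (≡.refl , e) → ≡.refl , J∼.trans v {k′ ∙ g} {k ∙ g} {y} (J∼.sym v {k ∙ g} {k′ ∙ g} (coset-S′ k∼k′)) e })
        (λ { (≡.refl , e) → ≡.refl , J∼.trans v {k ∙ g} {k′ ∙ g} {y} (coset-S′ k∼k′) e })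
        (λ _ → ≈ᴹ-refl)

      Z : Carrierᴹ
      Z = ⟨ x , ψ′ ε ⟩

      -- Invariance is applied against the cut-off `ψ′ k`, so it has to hold in the cover;
      -- invariance of the image in `P` would not separate the cosets.
      ⟨⟩-translate : ∀ {k} → ⌞ L ⌟ k → ⟨ x , ψ′ k ⟩ ≈ᴹ k ▷ Z
      ⟨⟩-translate {k} k∈L = begin
        ⟨ x , ψ′ k ⟩                              ≈⟨ invariant k∈L _ (ψ′-test k) ⟨
        ⟨ _▷ᶜ_ H oH H-fixes k x , ψ′ k ⟩          ≈⟨ ⟨⟩-mapᶜ _ x ⟩
        ⟨ x , ψ′ k ∘ shift H oH H-fixes k ⟩       ≈⟨ ⟨⟩-cong x translate ⟩
        ⟨ x , (k ▷_) ∘ ψ′ ε ⟩                     ≈⟨ IsLinear.⟨⟩-homo (▷-linear k) x ⟩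
        k ▷ Z                                     ∎
        where
        translate : ∀ z → ψ′ k (shift H oH H-fixes k z) ≈ᴹ k ▷ ψ′ ε z
        translate (y , u) = ≈ᴹ-trans
          (when-cong em em
            (λ { (u≡v , e) → u≡v , J.resp-≈ v (solve 3 (λ g k y → ⊖ (k ⊞ g) ⊞ (k ⊞ y) ⊜ ⊖ (∅ ⊞ g) ⊞ y) G.refl g k y) e })
            (λ { (u≡v , e) → u≡v , J.resp-≈ v (solve 3 (λ g k y → ⊖ (∅ ⊞ g) ⊞ y ⊜ ⊖ (k ⊞ g) ⊞ (k ⊞ y)) G.refl g k y) e })
            (λ _ → ▷-assoc k y u))
          (≈ᴹ-sym (IsLinear.when-homo (▷-linear k) em))

      -- On the coset of `g`, every `y ▷ v` is a multiple of `g ▷ v`, on which `s` acts by the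
      -- scalar of `g⁻¹ s g` on `v`. This scalar is independent of `y` and so passes through the
      -- pairing.
      Z-eigen : ∀ {s} → ⌞ S ⌟ s → ∃[ a ] s ▷ Z ≈ᴹ a *ₗ Z
      Z-eigen {s} (_ , s∈) = let (a , e) = ·C-eigenvector {H₀ v} (H₀-fixes v) s∈ in a , (begin
        s ▷ Z                            ≈⟨ IsLinear.⟨⟩-homo (▷-linear s) x ⟨
        ⟨ x , (s ▷_) ∘ ψ′ ε ⟩            ≈⟨ ⟨⟩-cong x (pointwise e) ⟩
        ⟨ x , (a *ₗ_) ∘ ψ′ ε ⟩           ≈⟨ IsLinear.⟨⟩-homo (scaling-linear a) x ⟩
        a *ₗ Z                           ∎)
        where
        pointwise : ∀ {a} → (g ⁻¹ ∙ s ∙ g) ▷ v ≈ᴹ a *ₗ v → ∀ z → s ▷ ψ′ ε z ≈ᴹ a *ₗ ψ′ ε z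
        pointwise {a} e (y , u) = ≈ᴹ-trans (IsLinear.when-homo (▷-linear s) em)
          (≈ᴹ-trans (when-cong em em id id (λ { (≡.refl , g∼y) → scalar g∼y }))
            (≈ᴹ-sym (IsLinear.when-homo (scaling-linear a) em)))
          where
          scalar : (ε ∙ g) ∼[ H v ·C ] y → s ▷ y ▷ v ≈ᴹ a *ₗ y ▷ v
          scalar g∼y = let (b , e′) = ·C-eigenvector {H v} (H-fixes v) g∼y in begin
            s ▷ y ▷ v                          ≈⟨ ▷-cong G.refl (yv b e′) ⟩
            s ▷ (b *ₗ g ▷ v)                   ≈⟨ ▷-*ₗ s b _ ⟩
            b *ₗ s ▷ g ▷ v                     ≈⟨ *ₗ-congˡ sgv ⟩
            b *ₗ a *ₗ g ▷ v                    ≈⟨ IsLinear.*-homo (scaling-linear a) b _ ⟨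
            a *ₗ b *ₗ g ▷ v                    ≈⟨ *ₗ-congˡ (yv b e′) ⟨
            a *ₗ y ▷ v                         ∎
            where
            yv : ∀ b → ((ε ∙ g) ⁻¹ ∙ y) ▷ v ≈ᴹ b *ₗ v → y ▷ v ≈ᴹ b *ₗ g ▷ v
            yv b e′ = begin
              y ▷ v                                ≈⟨ ▷-cong (solve 2 (λ g y → y ⊜ g ⊞ (⊖ (∅ ⊞ g) ⊞ y)) G.refl g y) ≈ᴹ-refl ⟩
              (g ∙ ((ε ∙ g) ⁻¹ ∙ y)) ▷ v           ≈⟨ ▷-assoc g _ v ⟩
              g ▷ ((ε ∙ g) ⁻¹ ∙ y) ▷ v             ≈⟨ ▷-cong G.refl e′ ⟩
              g ▷ (b *ₗ v)                         ≈⟨ ▷-*ₗ g b v ⟩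
              b *ₗ g ▷ v                           ∎
            sgv : s ▷ g ▷ v ≈ᴹ a *ₗ g ▷ v
            sgv = begin
              s ▷ g ▷ v                            ≈⟨ ▷-assoc s g v ⟨
              (s ∙ g) ▷ v                          ≈⟨ ▷-cong (solve 2 (λ g s → s ⊞ g ⊜ g ⊞ (⊖ g ⊞ s ⊞ g)) G.refl g s) ≈ᴹ-refl ⟩
              (g ∙ (g ⁻¹ ∙ s ∙ g)) ▷ v             ≈⟨ ▷-assoc g _ v ⟩
              g ▷ (g ⁻¹ ∙ s ∙ g) ▷ v               ≈⟨ ▷-cong G.refl e ⟩
              g ▷ (a *ₗ v)                         ≈⟨ ▷-*ₗ g a v ⟩
              a *ₗ g ▷ v                           ∎

      -- Fixed and not merely scaled: left translation by `s` preserves the coset `g (H v · C)`, so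
      -- `ψ′ s` and `ψ′ ε` agree, and invariance of `x` does the rest.
      Z-fixed : ⌞ S′ ⌟ ⊆ ⌞ stabilizer Z ⌟
      Z-fixed {s} s∈S′ = begin
        s ▷ Z             ≈⟨ ⟨⟩-translate (proj₁ s∈S′) ⟨
        ⟨ x , ψ′ s ⟩      ≈⟨ ⟨⟩-cong x (ψ′-resp s∼ε) ⟩
        Z                 ∎
        where
        s∼ε : s ∼[ S′ ] ε
        s∼ε = Subgroup.resp-≈ S′ (solve 1 (λ s → ⊖ s ⊜ ⊖ s ⊞ ∅) G.refl s) (Subgroup.⁻¹-closed S′ {s} s∈S′)

      -- For `k` and `k′` in `L`, the cosets of `k g` and `k′ g` coincide exactly when `k` and `k′`
      -- agree modulo `S′`, so at most one summand is supported at a given point.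
      class≈∑ : ∀ {n} {t : Fin n → G.Carrier} → IsTransversal L S′ t →
                ∀ z → restrict em (_≃ (g , v)) ψ z ≈ᴹ sum (λ i → ψ′ (t i) z)
      class≈∑ {n} {t} T z@(y , u) with em {z ≃ (g , v)}
      ... | no ∉class = ≈ᴹ-sym (∑-zero {n} _ λ i → when-no em λ { (u≡v , e) → ∉class (u≡v , t i , T.member i , e) })
        where
        module T = IsTransversal T
      ... | yes (≡.refl , l , l∈L , lg∼y) with IsTransversal.cover T l∈L
      ... | i , l∼t = ≈ᴹ-sym (≈ᴹ-trans (∑-single {n} _ i λ j i≢j → when-no em λ { (_ , e) → i≢j (unique e) })
                                       (when-yes em (≡.refl , tg∼y)))
        where
        module T = IsTransversal T
        tg∼y : (t i ∙ g) ∼[ H v ·C ] y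
        tg∼y = J∼.trans v {t i ∙ g} {l ∙ g} {y} (J∼.sym v {l ∙ g} {t i ∙ g} (coset-S′ l∼t)) lg∼y
        unique : ∀ {j} → (t j ∙ g) ∼[ H v ·C ] y → i ≡ j
        unique {j} e = T.injective
          (L.∙-closed (L.⁻¹-closed (T.member i)) (T.member j) ,
           S′-coset (J∼.trans v {t i ∙ g} {y} {t j ∙ g} tg∼y (J∼.sym v {t j ∙ g} {y} e)))

      class-vanishes : ∀ {l m n} {t : Fin l → G.Carrier} {r : Fin m → G.Carrier} {q : Fin n → G.Carrier} →
                       IsTransversal L S′ t → IsTransversal L S r → IsTransversal S S′ q → p ∣ n →
                       ⟨ x , restrict em (_≃ (g , v)) ψ ⟩ ≈ᴹ 0ᴹ
      class-vanishes {l} {m} {n} {t} {r} {q} T R Q p∣n = begin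
        ⟨ x , restrict em (_≃ (g , v)) ψ ⟩
          ≈⟨ ⟨⟩-cong x (class≈∑ T) ⟩
        ⟨ x , (λ z → sum (λ i → ψ′ (t i) z)) ⟩
          ≈⟨ ⟨⟩-∑ x (λ i → ψ′ (t i)) ⟩
        sum (λ i → ⟨ x , ψ′ (t i) ⟩)
          ≈⟨ ∑-tower +ᴹ-commutativeMonoid {L} {S} {S′} proj₁ S′⊆S T R Q
               (λ k → ⟨ x , ψ′ k ⟩) (λ _ k∼k′ → ⟨⟩-cong x (ψ′-resp k∼k′)) ⟩
        sum (λ j → sum (λ k → ⟨ x , ψ′ (r j ∙ q k) ⟩))
          ≈⟨ sum-cong-≋ {m} (λ j → sum-cong-≋ {n} (λ k → ≈ᴹ-trans
               (⟨⟩-translate (L.∙-closed (IsTransversal.member R j) (proj₁ (IsTransversal.member Q k)))) (▷-assoc (r j) (q k) Z))) ⟩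
        sum (λ j → sum (λ k → r j ▷ q k ▷ Z))
          ≈⟨ ∑-zero {m} _ (λ j → begin
               sum (λ k → r j ▷ q k ▷ Z)    ≈⟨ IsLinear.∑-homo (▷-linear (r j)) (λ k → q k ▷ Z) ⟨
               r j ▷ sum (λ k → q k ▷ Z)    ≈⟨ ▷-cong G.refl (∑-orbit≈0 {S} {S′} S′⊆S Q p∣n Z-eigen Z-fixed) ⟩
               r j ▷ 0ᴹ                     ≈⟨ IsLinear.0-homo (▷-linear (r j)) ⟩
               0ᴹ                           ∎) ⟩
        0ᴹ ∎

-- Vanishing of each vector of a projective representation.

theorem4p4 : ∀ {ℓ : Level} → ExcludedMiddle ℓ →
    (F : Field ℓ) (p : ℕ) → p > 0 → HasCharacteristic F p →
    (G : TopologicalGroup ℓ) → IsLocallyProP p G →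
    (C : Subgroup (TopologicalGroup.group G)) →
    IsCentral C → TopologicalGroup.IsClosed G ⌞ C ⌟ →
    (K : Subgroup (TopologicalGroup.group G)) →
    TopologicalGroup.IsOpen G ⌞ K ⌟ → IsProP p (subgroupᵗ G K) →
    IsFair G C K →
    (χ : ContinuousCharacter F (subgroupᵗ G C)) →
    let open Mod F G C χ in
    ¬ (∃[ P ] (IsProjective P × ¬ IsZero P))
theorem4p4 {ℓ} em F p p>0 char G _ C central _ K oK proP fair χ (P , projective , P≢0) = P≢0 vanish
  where
  open Mod F G C χ
  module G = TopologicalGroup G
  open SmoothRep P
  open OpenSubgroups G
  open CentralProduct G C central
  open Cosets em G.group
  open FairChain em G C central K fair
  open CoveringRep F G C χ central P
  open InvariantVectors em F char G C central χ P
  open Pairing F vectorSpace (G.Carrier × Carrierᴹ)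
  open IsProP proP using (compact)

  K∩stabilizer : Carrierᴹ → OpenIn
  K∩stabilizer v = record { sub = K ⊓ stabilizer v ; open′ = G.open-∩ oK (smooth v) ; ⊆K = proj₁ }

  vanish : ∀ w → w ≈ᴹ 0ᴹ
  vanish w = ≈ᴹ-trans (≈ᴹ-sym (section w)) (⟨⟩-partition em (≃-isEquivalence L H₀ H H₀-fixes H⊆H₀ oH) x ψ class)
    where
    L : Subgroup G.group
    L = sub (K∩stabilizer w)

    L-cover : ∃[ n ] Σ[ c ∈ (Fin n → G.Carrier) ] ((∀ i → ⌞ K ⌟ (c i)) × (∀ {k} → ⌞ K ⌟ k → ∃[ i ] k ∼[ L ] c i))
    L-cover = finite-cover em {K} compact L (open′ (K∩stabilizer w))

    n : ℕ
    n = proj₁ L-cover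

    H₀ H : Carrierᴹ → Subgroup G.group
    H₀ v = sub (K∩stabilizer v)
    -- One step more than the `n` listed cosets of `L`, as the pigeonhole argument requires.
    -- Repetitions in the list do no harm, and `n` is independent of `v` and `g`.
    H v  = sub (chain (K∩stabilizer v) (suc n))

    H₀-fixes : ∀ v → ⌞ H₀ v ⌟ ⊆ ⌞ stabilizer v ⌟
    H₀-fixes v = proj₂

    H⊆H₀ : ∀ v → ⌞ H v ⌟ ⊆ ⌞ H₀ v ⌟
    H⊆H₀ v = chain-antitone (K∩stabilizer v) {0} {suc n} z≤n

    oH : ∀ v → G.IsOpen ⌞ H v ⌟
    oH v = open′ (chain (K∩stabilizer v) (suc n))

    fixes : ∀ v → ⌞ H v ⌟ ⊆ ⌞ stabilizer v ⌟
    fixes = H-fixes L H₀ H H₀-fixes H⊆H₀ oH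

    identity : Hom P P
    identity = record
      { ⟦_⟧         = id
      ; linear      = Identity.isLeftModuleHomomorphism rawLeftModule ≈ᴹ-refl
      ; equivariant = λ _ _ → ≈ᴹ-refl
      }

    lift : Σ[ f̃ ∈ Hom P (rep H oH fixes) ] ((covering H oH fixes ⊚ f̃) ≋ identity)
    lift = projective (covering H oH fixes) (covering-epi H oH fixes) identity

    section : ∀ w → Hom.⟦ covering H oH fixes ⟧ (Hom.⟦ proj₁ lift ⟧ w) ≈ᴹ w
    section = proj₂ lift

    x : SmoothRep.Carrierᴹ (rep H oH fixes)
    x = Hom.⟦ proj₁ lift ⟧ w

    invariant : ∀ {l} → ⌞ L ⌟ l → ∀ φ → IsTest H oH fixes φ → ⟨ _▷ᶜ_ H oH fixes l x , φ ⟩ ≈ᴹ ⟨ x , φ ⟩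
    invariant {l} (_ , lw≈w) φ t = ≈ᴹ-trans (≈ᴹ-sym (Hom.equivariant (proj₁ lift) l w φ t)) (s.⟦⟧-cong lw≈w φ t)
      where
      module s = LeftModuleMorphisms.IsLeftModuleHomomorphism (Hom.linear (proj₁ lift))

    class : ∀ z → ⟨ x , restrict em (λ y → _≃_ L H₀ H H₀-fixes H⊆H₀ oH y z) ψ ⟩ ≈ᴹ 0ᴹ
    class (g , v) = class-vanishes L H₀ H H₀-fixes H⊆H₀ oH x invariant g v T R Q p∣m
      where
      S₁ S₁′ A N : Subgroup G.group
      S₁  = S L H₀ H H₀-fixes H⊆H₀ oH x invariant g v
      S₁′ = S′ L H₀ H H₀-fixes H⊆H₀ oH x invariant g v
      -- Leaving out the factor `C` makes this an intersection of sets already known to be open, and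
      -- it still lies in `S₁′`.
      A = L ⊓ H v ^ᶜ g
      N = core em {K} compact A

      S₁′⊆S₁ : ⌞ S₁′ ⌟ ⊆ ⌞ S₁ ⌟
      S₁′⊆S₁ = S′⊆S L H₀ H H₀-fixes H⊆H₀ oH x invariant g v

      N⊆S₁′ : ⌞ N ⌟ ⊆ ⌞ S₁′ ⌟
      N⊆S₁′ {y} y∈N = let (y∈L , y∈H) = core-⊆ em {K} compact A {y} y∈N in y∈L , ⊆·C (H v) y∈H

      K-transversal = core-transversal em {p} {K} oK proP A
        (G.open-∩ (open′ (K∩stabilizer w)) (open-conjugate (oH v) g))
      tᴷ = proj₁ (proj₂ K-transversal)
      Tᴷ = proj₂ (proj₂ K-transversal)

      cover : ∀ {y} → ⌞ K ⌟ y → ∃[ i ] y ∼[ S₁′ ] tᴷ i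
      cover y∈K = let (i , e) = IsTransversal.cover Tᴷ y∈K in i , N⊆S₁′ e

      T = proj₂ (proj₂ (transversal L S₁′ tᴷ (λ y∈L → cover (proj₁ y∈L))))
      R = proj₂ (proj₂ (transversal L S₁ tᴷ (λ y∈L → let (i , e) = cover (proj₁ y∈L) in i , S₁′⊆S₁ e)))
      S₁-transversal = transversal S₁ S₁′ tᴷ (λ y∈S → cover (proj₁ (proj₁ y∈S)))
      Q = proj₂ (proj₂ S₁-transversal)

      -- Index 1 would put all of `S₁` inside `S₁′`, so the chain would become constant after
      -- intersecting with `L`.
      m≢1 : ¬ proj₁ S₁-transversal ≡ 1
      m≢1 m≡1 = chain-strict (K∩stabilizer v) {L} (proj₁ (proj₂ L-cover)) (proj₂ (proj₂ (proj₂ L-cover))) g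
        λ {s} s∈L s∈ → proj₂ (one-coset S₁ S₁′ Q m≡1 {s} (s∈L , s∈))

      p∣m : p ∣ proj₁ S₁-transversal
      p∣m = prime∣divisor-of-power (characteristic-prime em F p>0 char) (proj₁ K-transversal)
        (index-divides em {K} {S₁} {S₁′} {N} N⊆S₁′ S₁′⊆S₁ (λ y∈S → proj₁ (proj₁ y∈S)) Tᴷ Q) m≢1
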